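{- For all $\rho,\tau\in\mathbb{N}$, every graph $G$ with $\mathrm{tw}(G)<\tau$ and no induced minor isomorphic to $\mathrm{bin}_\rho$ satisfies $\mathrm{pw}(G)<\tau^{6\rho+2}$.
   Context: Graphs are finite and simple; $\mathbb{N}$ is the positive integers. $\mathrm{tw}$ and $\mathrm{pw}$ denote treewidth and pathwidth. An induced minor of $G$ is a graph obtained from $G$ by deleting vertices and contracting edges (removing loops and parallel edges). For $r\ge 0$, $\mathrm{bin}_r$ is the full binary tree of radius $r$: a rooted tree in which every vertex at distance less than $r$ from the root has exactly two children and all leaves are at distance exactly $r$ from the root. -}

module Defs where

open import Data.Nat using (ℕ; zero; suc; _+_; _*_; _∸_; _^_; _≤_; _<_; _≡ᵇ_; s≤s)
open import Data.Nat.Properties using (≡ᵇ⇒≡; <⇒≢; m≤m+n; m≤n⇒m≤1+n)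
open import Data.Bool using (Bool; true; false; _∨_; T)
open import Data.Bool.Properties using (∨-comm)
open import Data.Fin using (Fin; toℕ; inject₁; fromℕ) renaming (zero to fzero; suc to fsuc; _≤_ to _≤ᶠ_)
open import Data.Fin.Subset using (Subset; _∈_; ∣_∣)
open import Data.Product using (Σ; ∃; _×_; _,_)
open import Data.Unit using (⊤; tt)
open import Data.Empty using (⊥; ⊥-elim)
open import Function using (_⇔_)
open import Function.Definitions using (Injective)
open import Relation.Nullary using (¬_)
open import Relation.Binary.PropositionalEquality using (_≡_; _≢_; refl; sym; cong; subst)

record Graph : Set where
  field
    size       : ℕ
    adj        : Fin size → Fin size → Bool
    adj-sym    : ∀ x y → adj x y ≡ adj y x
    adj-irrefl : ∀ x → adj x x ≡ false
open Graph public

V : Graph → Set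
V G = Fin (size G)

Adj : (G : Graph) → V G → V G → Set
Adj G x y = adj G x y ≡ true

data WalkIn (G : Graph) (S : V G → Set) : V G → V G → Set where
  here : ∀ {u} → S u → WalkIn G S u u
  step : ∀ {u w v} → S u → Adj G u w → WalkIn G S w v → WalkIn G S u v

ConnectedSet : (G : Graph) → (V G → Set) → Set
ConnectedSet G S = ∀ u v → S u → S v → WalkIn G S u v

Connected : Graph → Set
Connected G = ConnectedSet G (λ _ → ⊤)

HasCycle : Graph → Set
HasCycle G =
  Σ ℕ λ k → Σ (Fin (suc (suc (suc k))) → V G) λ c →
    Injective _≡_ _≡_ c ×
    (∀ (i : Fin (suc (suc k))) → Adj G (c (inject₁ i)) (c (fsuc i))) ×
    Adj G (c (fromℕ (suc (suc k)))) (c fzero)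

IsTree : Graph → Set
IsTree G = (1 ≤ size G) × Connected G × ¬ HasCycle G

record TreeDecomposition (G : Graph) : Set where
  field
    tree       : Graph
    isTree     : IsTree tree
    bag        : V tree → Subset (size G)
    cover-vert : ∀ (v : V G) → ∃ λ t → v ∈ bag t
    cover-edge : ∀ (u v : V G) → Adj G u v → ∃ λ t → (u ∈ bag t) × (v ∈ bag t)
    coherent   : ∀ (v : V G) → ConnectedSet tree (λ t → v ∈ bag t)
open TreeDecomposition public

record PathDecomposition (G : Graph) : Set where
  field
    len        : ℕ
    pbag       : Fin (suc len) → Subset (size G)
    pcover-vert : ∀ (v : V G) → ∃ λ i → v ∈ pbag i
    pcover-edge : ∀ (u v : V G) → Adj G u v → ∃ λ i → (u ∈ pbag i) × (v ∈ pbag i)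
    pcoherent  : ∀ (v : V G) (i j k : Fin (suc len)) → i ≤ᶠ j → j ≤ᶠ k →
                 v ∈ pbag i → v ∈ pbag k → v ∈ pbag j
open PathDecomposition public

-- width = max bag size - 1, so  width < k  iff  every bag has size ≤ k.
TreewidthLess : Graph → ℕ → Set
TreewidthLess G k = Σ (TreeDecomposition G) λ D → ∀ t → ∣ bag D t ∣ ≤ k

PathwidthLess : Graph → ℕ → Set
PathwidthLess G k = Σ (PathDecomposition G) λ D → ∀ i → ∣ pbag D i ∣ ≤ k

record InducedMinorModel (H G : Graph) : Set₁ where
  field
    branch    : V H → V G → Set
    nonempty  : ∀ x → ∃ λ v → branch x v
    connected : ∀ x → ConnectedSet G (branch x)
    disjoint  : ∀ x y → x ≢ y → ∀ v → branch x v → branch y v → ⊥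
    edges     : ∀ x y → x ≢ y →
                (Adj H x y ⇔ (∃ λ u → ∃ λ v → branch x u × branch y v × Adj G u v))

HasInducedMinor : Graph → Graph → Set₁
HasInducedMinor G H = InducedMinorModel H G

-- The full binary tree of radius r, in heap numbering: vertices
-- 0 .. 2^(r+1) - 2, children of i are 2i+1 and 2i+2.

child : ℕ → ℕ → Bool
child i j = (j ≡ᵇ suc (i + i)) ∨ (j ≡ᵇ suc (suc (i + i)))

private
  ≡ᵇ-false : ∀ n m → n < m → (n ≡ᵇ m) ≡ false
  ≡ᵇ-false n m n<m with n ≡ᵇ m in eq
  ... | false = refl
  ... | true = ⊥-elim (<⇒≢ n<m (≡ᵇ⇒≡ n m (subst T (sym eq) tt)))

  child-irrefl : ∀ n → child n n ≡ false
  child-irrefl n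
    rewrite ≡ᵇ-false n (suc (n + n)) (s≤s (m≤m+n n n))
          | ≡ᵇ-false n (suc (suc (n + n))) (s≤s (m≤n⇒m≤1+n (m≤m+n n n))) = refl

bin : ℕ → Graph
bin r = record
  { size       = 2 ^ suc r ∸ 1
  ; adj        = λ i j → child (toℕ i) (toℕ j) ∨ child (toℕ j) (toℕ i)
  ; adj-sym    = λ i j → ∨-comm (child (toℕ i) (toℕ j)) (child (toℕ j) (toℕ i))
  ; adj-irrefl = λ i → cong (λ b → b ∨ b) (child-irrefl (toℕ i))
  }

{-# OPTIONS --safe #-}
module Submission where

open import Defs
open import Data.Nat using (ℕ; zero; suc; _+_; _*_; _∸_; _^_; _≤_; _<_; _⊔_; _/_; _%_; z≤n; s≤s; s≤s⁻¹)
import Data.Nat as ℕ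
open import Data.Nat.Properties
  using (≤-refl; ≤-trans; ≤-reflexive; <-≤-trans; ≤-total; ⊔-sel; m≤m⊔n; m≤n⊔m; <⇒≱; ≰⇒>; <⇒≤; ≤-antisym
         ; m≤n⇒m<n∨m≡n; +-monoʳ-≤; +-mono-≤; +-cancelʳ-≤; +-cancelʳ-<; +-suc; ≤∧≢⇒<; <-cmp; n<1+n; ≤-<-trans
         ; m≤m+n; module ≤-Reasoning; <-irrefl; <-asym; ≮⇒≥; +-identityʳ; *-monoʳ-≤; *-monoˡ-≤; *-mono-≤; *-suc
         ; *-comm; ^-monoʳ-≤; ^-monoˡ-≤; ^-distribˡ-+-*; n≤1+n; m^n>0; ≡ᵇ⇒≡; ≡⇒≡ᵇ; m+[n∸m]≡n; *-identityʳ)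
open import Data.Nat.DivMod
  using (/-monoˡ-≤; [m+kn]%n≡m%n; m≡m%n+[m/n]*n; m<n⇒m%n≡m; m<n⇒m/n≡0; +-distrib-/-∣ʳ; m*n/n≡m)
open import Data.Nat.Divisibility using (n∣m*n)
open import Data.Nat.Binary using (ℕᵇ; zero; 2[1+_]; 1+[2_])
import Data.Nat.Binary as ℕᵇ
import Data.Nat.Binary.Properties as ℕᵇ
open import Data.Nat.Solver using (module +-*-Solver)
open import Data.Bool using (Bool; true; false; T; if_then_else_)
import Data.Bool.Properties as 𝔹
open import Data.Bool.Properties using (T-∨; T-≡)
open import Data.Fin using (Fin; zero; suc; toℕ; fromℕ; fromℕ<; inject₁)
open import Data.Fin.Properties using (_≟_; any?; all?; toℕ-injective; toℕ<n; toℕ-fromℕ<; fromℕ<-toℕ)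
open import Data.Fin.Subset using (Subset; _∈_; _∉_; ∣_∣; ⁅_⁆; _-_; _∪_)
import Data.Fin.Subset as Sub
open import Data.Fin.Subset.Properties
  using (_∈?_; p⊆q⇒∣p∣≤∣q∣; p⊂q⇒∣p∣<∣q∣; x∈p⇒∣p-x∣<∣p∣; x∈p∧x≢y⇒x∈p-y; p─q⊆p; p⊆p∪q; q⊆p∪q; ∣p∣≤n; ∈⊤; nonempty?
         ; ∣⊥∣≡0; x∈⁅x⁆; x∈⁅y⁆⇒x≡y; ∣⁅x⁆∣≡1)
open import Data.Vec using (tabulate; []; _∷_; here; there)
open import Data.Vec.Properties using (lookup⇒[]=; []=⇒lookup; lookup∘tabulate)
open import Data.List using (List; []; _∷_; _∷ʳ_; length)
open import Data.List.Properties using (∷ʳ-injectiveˡ; ∷ʳ-injectiveʳ; length-++)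
open import Data.Product using (Σ; ∃; _×_; _,_; proj₁; proj₂)
open import Data.Sum using (_⊎_; inj₁; inj₂)
import Data.Sum as Sum
open import Data.Empty using (⊥; ⊥-elim)
open import Data.Unit using (⊤; tt)
open import Function using (_∘_; id; mk⇔; Equivalence)
open import Function.Definitions using (Injective)
open import Relation.Nullary using (¬_; Dec; yes; no; does)
open import Relation.Nullary.Decidable using (_×-dec_; _⊎-dec_; _→-dec_; ¬?; map′; dec-true; decidable-stable)
open import Relation.Unary using (Decidable)
open import Relation.Binary using (tri<; tri≈; tri>)
open import Relation.Binary.PropositionalEquality using (_≡_; _≢_; refl; sym; trans; cong; cong₂; subst)

-- A tree decomposition yields an elimination order in which every region D v (the descendants of v in the
-- elimination tree) is connected and has, together with v, a boundary inside one bag.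
--
-- Call D x heavy of degree r + 1 if from each of its vertices e one can reach two disjoint heavy regions of degree r
-- inside D x, each while avoiding the other. If this fails at e, the minimal heavy regions missing e are linearly
-- ordered by separation from e. Sweeping over them, and additionally keeping the fronts of the ancestors of e and of
-- the two adjacent heavy regions, costs 5 τ and leaves only lighter regions. So a graph without regions
-- of degree r has pathwidth less than 5 τ r.
--
-- Conversely, bin ρ is built from forks, where the root branch set is the component of e outside the two prongs.
-- For this to be an induced minor, the deeper branch sets must see nothing outside their own prong. If suitable prongs
-- are missing below nested vertices y₁, y₂, …, then every candidate prong v deep enough has a neighbour in each of the
-- disjoint sets between consecutive yᵢ, which is impossible for more than τ steps because the boundary of D v is small.
-- Hence degree τ + τ² + … + τ^ρ ≤ τ^(ρ+1) forces bin ρ, and 5 τ · τ^(ρ+1) ≤ τ^(6ρ+2) for τ ≥ 2.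

-- Decidable subsets and extrema over `Fin n`.

module _ {n : ℕ} where

  ⟦_⟧ : {P : Fin n → Set} → Decidable P → Subset n
  ⟦ P? ⟧ = tabulate (λ x → does (P? x))

  ∈⟦⟧⁺ : {P : Fin n → Set} (P? : Decidable P) → ∀ {x} → P x → x ∈ ⟦ P? ⟧
  ∈⟦⟧⁺ P? {x} px = lookup⇒[]= x _ (trans (lookup∘tabulate _ x) (dec-true (P? x) px))

  ∈⟦⟧⁻ : {P : Fin n → Set} (P? : Decidable P) → ∀ {x} → x ∈ ⟦ P? ⟧ → P x
  ∈⟦⟧⁻ P? {x} x∈ with P? x | trans (sym (lookup∘tabulate (λ y → does (P? y)) x)) ([]=⇒lookup x∈)
  ... | yes px | _ = px
  ... | no _ | ()

  ⟦⟧-mono-< : {P Q : Fin n → Set} (P? : Decidable P) (Q? : Decidable Q) →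
              (∀ x → P x → Q x) → ∀ y → Q y → ¬ P y → ∣ ⟦ P? ⟧ ∣ < ∣ ⟦ Q? ⟧ ∣
  ⟦⟧-mono-< P? Q? P⊆Q y qy ¬py = p⊂q⇒∣p∣<∣q∣
    ((λ x∈ → ∈⟦⟧⁺ Q? (P⊆Q _ (∈⟦⟧⁻ P? x∈))) , y , ∈⟦⟧⁺ Q? qy , ¬py ∘ ∈⟦⟧⁻ P?)

¬∀→∃ : ∀ {n} {P Q : Fin n → Set} → Decidable P → Decidable Q →
       ¬ (∀ x → P x → Q x) → ∃ λ x → P x × ¬ Q x
¬∀→∃ P? Q? ¬all with any? (λ x → P? x ×-dec ¬? (Q? x))
... | yes found = found
... | no none = ⊥-elim (¬all λ x px → decidable-stable (Q? x) (λ ¬q → none (x , px , ¬q)))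

-- The value 0 also covers an empty `P`, which keeps the function total; a positive maximum is
-- always attained.
maximum : ∀ {n} {P : Fin n → Set} → Decidable P → (f : Fin n → ℕ) →
          Σ ℕ λ m → (∀ x → P x → f x ≤ m) × (m ≡ 0 ⊎ ∃ λ x → P x × f x ≡ m)
maximum {zero} P? f = 0 , (λ ()) , inj₁ refl
maximum {suc n} P? f with maximum (P? ∘ suc) (f ∘ suc) | P? zero
... | m , ub , att | no ¬p = m , (λ { zero p → ⊥-elim (¬p p) ; (suc x) p → ub x p })
                               , Sum.map₂ (λ { (x , p , e) → suc x , p , e }) att
... | m , ub , att | yes p = f zero ⊔ m
    , (λ { zero _ → m≤m⊔n _ _ ; (suc x) q → ≤-trans (ub x q) (m≤n⊔m _ _) })
    , attained (⊔-sel (f zero) m) att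
  where
  attained : f zero ⊔ m ≡ f zero ⊎ f zero ⊔ m ≡ m → _ → _
  attained (inj₁ e) _ = inj₂ (zero , p , sym e)
  attained (inj₂ e) (inj₁ m≡0) = inj₁ (trans e m≡0)
  attained (inj₂ e) (inj₂ (x , q , fx)) = inj₂ (suc x , q , trans fx (sym e))

argmax : ∀ {n} {P : Fin n → Set} → Decidable P → (f : Fin n → ℕ) → ∃ P →
         ∃ λ x → P x × (∀ y → P y → f y ≤ f x)
argmax P? f (x₀ , p₀) with maximum P? f
... | m , ub , inj₂ (x , p , refl) = x , p , ub
... | .0 , ub , inj₁ refl = x₀ , p₀ , λ y py → ≤-trans (ub y py) z≤n

argmin : ∀ {n} {P : Fin n → Set} → Decidable P → (f : Fin n → ℕ) → ∃ P →
         ∃ λ x → P x × (∀ y → P y → f x ≤ f y)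
argmin {n} {P} P? f (x₀ , p₀) = go (f x₀) x₀ p₀ ≤-refl
  where
  go : ∀ b x → P x → f x ≤ b → ∃ λ x → P x × (∀ y → P y → f x ≤ f y)
  go zero x p fx≤0 = x , p , λ y _ → ≤-trans fx≤0 z≤n
  go (suc b) x p fx≤b with any? (λ y → P? y ×-dec (suc (f y) ℕ.≤? f x))
  ... | yes (y , py , fy<fx) = go b y py (s≤s⁻¹ (≤-trans fy<fx fx≤b))
  ... | no none = x , p , λ y py → s≤s⁻¹ (≰⇒> (λ fy<fx → none (y , py , fy<fx)))

-- Walks: reachability, first exits and decidability.

module _ {G : Graph} where

  Adj? : ∀ x y → Dec (Adj G x y)
  Adj? x y = adj G x y 𝔹.≟ true

  Adj-sym : ∀ {x y} → Adj G x y → Adj G y x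
  Adj-sym {x} {y} a = trans (adj-sym G y x) a

  Adj-irrefl : ∀ {x y} → Adj G x y → x ≢ y
  Adj-irrefl {x} a refl with trans (sym (adj-irrefl G x)) a
  ... | ()

  walk-source : ∀ {S u v} → WalkIn G S u v → S u
  walk-source (here s) = s
  walk-source (step s _ _) = s

  walk-target : ∀ {S u v} → WalkIn G S u v → S v
  walk-target (here s) = s
  walk-target (step _ _ p) = walk-target p

  walk-mono : ∀ {S S′ u v} → (∀ z → S z → S′ z) → WalkIn G S u v → WalkIn G S′ u v
  walk-mono f (here s) = here (f _ s)
  walk-mono f (step s a p) = step (f _ s) a (walk-mono f p)

  walk-trans : ∀ {S u v w} → WalkIn G S u v → WalkIn G S v w → WalkIn G S u w
  walk-trans (here _) q = q
  walk-trans (step s a p) q = step s a (walk-trans p q)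

  walk-snoc : ∀ {S u v w} → WalkIn G S u v → Adj G v w → S w → WalkIn G S u w
  walk-snoc p a s = walk-trans p (step (walk-target p) a (here s))

  walk-sym : ∀ {S u v} → WalkIn G S u v → WalkIn G S v u
  walk-sym (here s) = here s
  walk-sym (step s a p) = walk-snoc (walk-sym p) (Adj-sym a) s

  -- Makes sets of the form `WalkIn G S u` connected: any two of their vertices are joined through
  -- `u` without leaving the set.
  walk-reach : ∀ {S u v} → WalkIn G S u v → WalkIn G (WalkIn G S u) u v
  walk-reach {S} {u} p = go (here (walk-source p)) p
    where
    go : ∀ {w v} → WalkIn G S u w → WalkIn G S w v → WalkIn G (WalkIn G S u) w v
    go q (here s) = here q
    go q (step s a p) = step q a (go (walk-snoc q a (walk-source p)) p)

  record Exit (S P : V G → Set) (u v : V G) : Set where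
    field
      {last next} : V G
      inside  : WalkIn G (λ z → S z × P z) u last
      edge    : Adj G last next
      S-next  : S next
      outside : ¬ P next
      rest    : WalkIn G S next v

  first-exit : ∀ {S P u v} → Decidable P → WalkIn G S u v → P u → ¬ P v → Exit S P u v
  first-exit P? (here _) pu ¬pv = ⊥-elim (¬pv pu)
  first-exit P? (step {w = w} s a p) pu ¬pv with P? w
  ... | no ¬pw = record { inside = here (s , pu) ; edge = a ; S-next = walk-source p ; outside = ¬pw ; rest = p }
  ... | yes pw = record
    { inside = step (s , pu) a inside ; edge = edge ; S-next = S-next ; outside = outside ; rest = rest }
    where open Exit (first-exit P? p pw ¬pv)

  -- Keep only the part of a walk after its last visit of u.
  avoid-or-leave : ∀ {S x v} u → v ≢ u → WalkIn G S x v →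
    WalkIn G (λ z → S z × z ≢ u) x v ⊎ ∃ λ w → Adj G u w × WalkIn G (λ z → S z × z ≢ u) w v
  avoid-or-leave u v≢u (here s) = inj₁ (here (s , v≢u))
  avoid-or-leave {x = x} u v≢u (step s a p) with avoid-or-leave u v≢u p
  ... | inj₂ r = inj₂ r
  ... | inj₁ q with x ≟ u
  ...   | yes refl = inj₂ (_ , a , q)
  ...   | no x≢u = inj₁ (step (s , x≢u) a q)

  private
    -- After its last visit of `u` a walk avoids `u`, so the search continues from a neighbour in a
    -- strictly smaller set.
    walk-fuel? : ∀ k {S} (S? : Decidable S) → ∣ ⟦ S? ⟧ ∣ ≤ k → ∀ u v → Dec (WalkIn G S u v)
    walk-fuel? k S? bound u v with S? u
    ... | no ¬su = no (¬su ∘ walk-source)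
    ... | yes su with v ≟ u
    ...   | yes refl = yes (here su)
    ...   | no v≢u with k
    ...     | zero = ⊥-elim (<⇒≱
                (⟦⟧-mono-< {P = λ _ → ⊥} (λ _ → no id) S? (λ _ ()) u su id) (≤-trans bound z≤n))
    ...     | suc k = map′
              (λ { (w , a , p) → step su a (walk-mono (λ _ → proj₁) p) })
              (λ p → Sum.[ (λ q → ⊥-elim (proj₂ (walk-source q) refl)) , id ]′ (avoid-or-leave u v≢u p))
              (any? λ w → Adj? u w ×-dec walk-fuel? k S′? smaller w v)
      where
      S′? = λ z → S? z ×-dec ¬? (z ≟ u)
      smaller = s≤s⁻¹ (≤-trans (⟦⟧-mono-< S′? S? (λ _ → proj₁) u su (λ s → proj₂ s refl)) bound)

  walk? : ∀ {S} → Decidable S → ∀ u v → Dec (WalkIn G S u v)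
  walk? S? = walk-fuel? _ S? ≤-refl

-- Layouts and path decompositions

∣∪∣≤ : ∀ {n} (p q : Subset n) → ∣ p ∪ q ∣ ≤ ∣ p ∣ + ∣ q ∣
∣∪∣≤ [] [] = z≤n
∣∪∣≤ (true ∷ p) (true ∷ q) = s≤s (≤-trans (∣∪∣≤ p q) (+-monoʳ-≤ ∣ p ∣ (<⇒≤ (n<1+n ∣ q ∣))))
∣∪∣≤ (true ∷ p) (false ∷ q) = s≤s (∣∪∣≤ p q)
∣∪∣≤ (false ∷ p) (true ∷ q) = ≤-trans (s≤s (∣∪∣≤ p q)) (≤-reflexive (sym (+-suc ∣ p ∣ ∣ q ∣)))
∣∪∣≤ (false ∷ p) (false ∷ q) = ∣∪∣≤ p q

module _ {G : Graph} where

  -- The i-th bag of the path decomposition of G[Y] that introduces each vertex u at time pos u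
  -- and keeps it for as long as it still has a neighbour to come.
  Bag : (V G → Set) → (V G → ℕ) → ℕ → V G → Set
  Bag Y pos i u = Y u × (pos u ≡ i ⊎ (pos u < i × ∃ λ v → Y v × Adj G u v × i ≤ pos v))

  -- The sets `bagᴸ i` only have to contain the true bags, so that upper bounds can be assembled as
  -- unions.
  record Layout (Y : V G → Set) (m : ℕ) : Set where
    field
      pos      : V G → ℕ
      bagᴸ     : ℕ → Subset (size G)
      bag-size : ∀ i → ∣ bagᴸ i ∣ ≤ m
      bag-⊇    : ∀ i u → Bag Y pos i u → u ∈ bagᴸ i
  open Layout

  layout-⊆ : ∀ {Y Z m} → (∀ u → Y u → Z u) → Layout Z m → Layout Y m
  layout-⊆ Y⊆Z L = record
    { pos = pos L ; bagᴸ = bagᴸ L ; bag-size = bag-size L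
    ; bag-⊇ = λ { i u (yu , inj₁ e) → bag-⊇ L i u (Y⊆Z u yu , inj₁ e)
                ; i u (yu , inj₂ (lt , v , yv , a , le)) →
                    bag-⊇ L i u (Y⊆Z u yu , inj₂ (lt , v , Y⊆Z v yv , a , le)) } }

  layout-≤ : ∀ {Y m k} → m ≤ k → Layout Y m → Layout Y k
  layout-≤ m≤k L = record
    { pos = pos L ; bagᴸ = bagᴸ L ; bag-size = λ i → ≤-trans (bag-size L i) m≤k ; bag-⊇ = bag-⊇ L }

  -- The decomposition uses the sets `Bag` themselves, in which every vertex occupies an interval;
  -- the sets `bagᴸ i` may violate this and only bound the sizes.
  layout⇒pathwidth : ∀ {m} → Layout (λ _ → ⊤) m → PathwidthLess G m
  layout⇒pathwidth {m} L = decomposition , λ i →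
      ≤-trans (p⊆q⇒∣p∣≤∣q∣ (λ {u} u∈ → bag-⊇ L (toℕ i) u (∈⟦⟧⁻ (Bag? (toℕ i)) u∈))) (bag-size L (toℕ i))
    where
    Bag? : ∀ i → Decidable (Bag (λ _ → ⊤) (pos L) i)
    Bag? i u = yes tt ×-dec ((pos L u ℕ.≟ i) ⊎-dec ((pos L u ℕ.<? i) ×-dec
               any? (λ v → yes tt ×-dec (Adj? {G = G} u v ×-dec (i ℕ.≤? pos L v)))))
    last : ℕ
    last = proj₁ (maximum {n = size G} {P = λ _ → ⊤} (λ _ → yes tt) (pos L))
    pos≤last : ∀ u → pos L u ≤ last
    pos≤last u = proj₁ (proj₂ (maximum {n = size G} {P = λ _ → ⊤} (λ _ → yes tt) (pos L))) u tt
    index : V G → Fin (suc last)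
    index u = fromℕ< (s≤s (pos≤last u))
    toℕ-index : ∀ u → pos L u ≡ toℕ (index u)
    toℕ-index u = sym (toℕ-fromℕ< (s≤s (pos≤last u)))
    own : ∀ u → u ∈ ⟦ Bag? (toℕ (index u)) ⟧
    own u = ∈⟦⟧⁺ (Bag? _) (tt , inj₁ (toℕ-index u))
    kept : ∀ u v → Adj G u v → pos L u < pos L v → u ∈ ⟦ Bag? (toℕ (index v)) ⟧
    kept u v a lt = ∈⟦⟧⁺ (Bag? _) (tt , inj₂ (subst (pos L u <_) (toℕ-index v) lt , v , tt , a ,
                                              ≤-reflexive (sym (toℕ-index v))))
    cover : ∀ u v → Adj G u v → ∃ λ i → u ∈ ⟦ Bag? (toℕ {suc last} i) ⟧ × v ∈ ⟦ Bag? (toℕ i) ⟧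
    cover u v a with <-cmp (pos L u) (pos L v)
    ... | tri< lt _ _ = index v , kept u v a lt , own v
    ... | tri≈ _ eq _ = index v , ∈⟦⟧⁺ (Bag? _) (tt , inj₁ (trans eq (toℕ-index v))) , own v
    ... | tri> _ _ gt = index u , own u , kept v u (Adj-sym {G = G} a) gt
    interval : ∀ i j k u → i ≤ j → j ≤ k → Bag (λ _ → ⊤) (pos L) i u → Bag (λ _ → ⊤) (pos L) k u →
               Bag (λ _ → ⊤) (pos L) j u
    interval i j k u i≤j j≤k bi bk with m≤n⇒m<n∨m≡n (≤-trans (introduced bi) i≤j)
      where
      introduced : ∀ {i} → Bag (λ _ → ⊤) (pos L) i u → pos L u ≤ i
      introduced (_ , inj₁ e) = ≤-reflexive e
      introduced (_ , inj₂ (lt , _)) = <⇒≤ lt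
    ... | inj₂ e = tt , inj₁ e
    interval i j k u i≤j j≤k bi (_ , inj₁ refl) | inj₁ lt = ⊥-elim (<⇒≱ lt j≤k)
    interval i j k u i≤j j≤k bi (_ , inj₂ (_ , v , _ , a , k≤)) | inj₁ lt =
      tt , inj₂ (lt , v , tt , a , ≤-trans j≤k k≤)
    decomposition : PathDecomposition G
    decomposition = record
      { len = last
      ; pbag = λ i → ⟦ Bag? (toℕ i) ⟧
      ; pcover-vert = λ v → index v , own v
      ; pcover-edge = cover
      ; pcoherent = λ v i j k i≤j j≤k v∈i v∈k → ∈⟦⟧⁺ (Bag? (toℕ j))
          (interval _ _ _ v i≤j j≤k (∈⟦⟧⁻ (Bag? (toℕ i)) v∈i) (∈⟦⟧⁻ (Bag? (toℕ k)) v∈k)) }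

  -- The layers of o are laid out one after the other; within layer c the vertices of B c come first.
  layered : ∀ {Y m b} (o : V G → ℕ) (B : ℕ → Subset (size G)) → (∀ c → ∣ B c ∣ ≤ b) →
    (∀ u v → Y u → Y v → Adj G u v → o u < o v → ∀ c → o u ≤ c → c ≤ o v → u ∈ B c) →
    (∀ c → Layout (λ u → Y u × o u ≡ c × u ∉ B c) m) →
    Layout Y (m + b)
  layered {Y} {m} {b} o B ∣B∣≤b crossing L = record
    { pos = time
    ; bagᴸ = λ i → bagᴸ (L (i / N)) (i % N) ∪ B (i / N)
    ; bag-size = λ i → ≤-trans (∣∪∣≤ (bagᴸ (L (i / N)) (i % N)) (B (i / N))) (+-mono-≤ (bag-size (L (i / N)) (i % N)) (∣B∣≤b (i / N)))
    ; bag-⊇ = covered }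
    where
    inner : V G → ℕ
    inner u = if does (u ∈? B (o u)) then 0 else pos (L (o u)) u
    K N : ℕ
    K = proj₁ (maximum {n = size G} {P = λ _ → ⊤} (λ _ → yes tt) inner)
    N = suc K
    inner<N : ∀ u → inner u < N
    inner<N u = s≤s (proj₁ (proj₂ (maximum {n = size G} {P = λ _ → ⊤} (λ _ → yes tt) inner)) u tt)
    -- Layer and inner time are recovered as quotient and remainder modulo `N`, which exceeds every
    -- inner time.
    time : V G → ℕ
    time u = inner u + o u * N
    time/N : ∀ u → time u / N ≡ o u
    time/N u = trans (+-distrib-/-∣ʳ (inner u) (n∣m*n (o u)))
                     (cong₂ _+_ (m<n⇒m/n≡0 (inner<N u)) (m*n/n≡m (o u) N))
    time%N : ∀ u → time u % N ≡ inner u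
    time%N u = trans ([m+kn]%n≡m%n (inner u) (o u) N) (m<n⇒m%n≡m (inner<N u))
    inner∈ : ∀ {u} → u ∈ B (o u) → inner u ≡ 0
    inner∈ {u} u∈ with u ∈? B (o u)
    ... | yes _ = refl
    ... | no u∉ = ⊥-elim (u∉ u∈)
    inner∉ : ∀ {u} → u ∉ B (o u) → inner u ≡ pos (L (o u)) u
    inner∉ {u} u∉ with u ∈? B (o u)
    ... | yes u∈ = ⊥-elim (u∉ u∈)
    ... | no _ = refl
    covered : ∀ i u → Bag Y time i u → u ∈ bagᴸ (L (i / N)) (i % N) ∪ B (i / N)
    covered i u (yu , inj₁ refl) = introduced (u ∈? B (o u))
      where
      introduced : Dec (u ∈ B (o u)) → u ∈ bagᴸ (L (time u / N)) (time u % N) ∪ B (time u / N)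
      introduced (yes u∈) = q⊆p∪q _ _ (subst (λ c → u ∈ B c) (sym (time/N u)) u∈)
      introduced (no u∉) = p⊆p∪q _ (bag-⊇ (L (time u / N)) (time u % N) u
        ( (yu , sym (time/N u) , subst (λ c → u ∉ B c) (sym (time/N u)) u∉)
        , inj₁ (trans (cong (λ c → pos (L c) u) (time/N u)) (sym (trans (time%N u) (inner∉ u∉))))))
    covered i u (yu , inj₂ (lt , v , yv , a , i≤)) = kept (m≤n⇒m<n∨m≡n (≤-trans ou≤c c≤ov))
      where
      ou≤c : o u ≤ i / N
      ou≤c = subst (_≤ i / N) (time/N u) (/-monoˡ-≤ N (<⇒≤ lt))
      c≤ov : i / N ≤ o v
      c≤ov = subst (i / N ≤_) (time/N v) (/-monoˡ-≤ N i≤)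
      kept : o u < o v ⊎ o u ≡ o v → u ∈ bagᴸ (L (i / N)) (i % N) ∪ B (i / N)
      kept (inj₁ ou<ov) = q⊆p∪q _ _ (crossing u v yu yv a ou<ov (i / N) ou≤c c≤ov)
      kept (inj₂ ou≡ov) = same (u ∈? B (i / N)) (v ∈? B (i / N))
        where
        t = i % N
        ou≡c : o u ≡ i / N
        ou≡c = ≤-antisym ou≤c (subst (i / N ≤_) (sym ou≡ov) c≤ov)
        ov≡c : o v ≡ i / N
        ov≡c = trans (sym ou≡ov) ou≡c
        i≡ : i ≡ t + (i / N) * N
        i≡ = m≡m%n+[m/n]*n i N
        inner-u<t : inner u < t
        inner-u<t = +-cancelʳ-< ((i / N) * N) (inner u) t
          (subst (λ c → inner u + c * N < t + (i / N) * N) ou≡c (subst (time u <_) i≡ lt))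
        t≤inner-v : t ≤ inner v
        t≤inner-v = +-cancelʳ-≤ ((i / N) * N) t (inner v)
          (subst (λ c → t + (i / N) * N ≤ inner v + c * N) ov≡c (subst (_≤ time v) i≡ i≤))
        same : Dec (u ∈ B (i / N)) → Dec (v ∈ B (i / N)) → u ∈ bagᴸ (L (i / N)) t ∪ B (i / N)
        same (yes u∈) _ = q⊆p∪q _ _ u∈
        -- Here `v` has inner time 0, so `u` cannot come strictly before it within the layer.
        same (no _) (yes v∈) = ⊥-elim (<⇒≱ inner-u<t
          (≤-trans t≤inner-v (subst (_≤ inner u) (sym (inner∈ (subst (λ c → v ∈ B c) (sym ov≡c) v∈))) z≤n)))
        same (no u∉) (no v∉) = p⊆p∪q _ (bag-⊇ (L (i / N)) t u
          ( (yu , ou≡c , u∉)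
          , inj₂ ( subst (_< t) (at ou≡c u∉) inner-u<t
                 , v , (yv , ov≡c , v∉) , a , subst (t ≤_) (at ov≡c v∉) t≤inner-v)))
          where
          at : ∀ {w} → o w ≡ i / N → w ∉ B (i / N) → inner w ≡ pos (L (i / N)) w
          at {w} e w∉ = trans (inner∉ (subst (λ c → w ∉ B c) (sym e) w∉)) (cong (λ c → pos (L c) w) e)

-- Elimination orders from tree decompositions

x∉p-x : ∀ {n} (x : Fin n) (p : Subset n) → x ∉ p - x
x∉p-x zero (s ∷ p) ()
x∉p-x (suc x) (s ∷ p) (there x∈) = x∉p-x x p x∈

module _ {T : Graph} where

  -- Simplicity is enforced by shrinking the set: once `u` is left, the rest of the path must avoid
  -- it.
  data SimplePath : (V T → Set) → ℕ → V T → V T → Set₁ where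
    here : ∀ {S u} → S u → SimplePath S 0 u u
    step : ∀ {S k u w v} → S u → Adj T u w → SimplePath (λ z → S z × z ≢ u) k w v → SimplePath S (suc k) u v

  simple-mono : ∀ {S S′ k u v} → (∀ z → S z → S′ z) → SimplePath S k u v → SimplePath S′ k u v
  simple-mono f (here s) = here (f _ s)
  simple-mono f (step s a p) = step (f _ s) a (simple-mono (λ { z (sz , ne) → f z sz , ne }) p)

  simplify : ∀ {S} → Decidable S → ∀ {u v} → WalkIn T S u v → ∃ λ k → SimplePath S k u v
  simplify S? = go _ S? ≤-refl
    where
    go : ∀ n {S} (S? : Decidable S) → ∣ ⟦ S? ⟧ ∣ ≤ n → ∀ {u v} → WalkIn T S u v → ∃ λ k → SimplePath S k u v
    go n S? bound {u} {v} p with v ≟ u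
    ... | yes refl = 0 , here (walk-source p)
    ... | no v≢u with avoid-or-leave u v≢u p | n
    ...   | inj₁ q | _ = ⊥-elim (proj₂ (walk-source q) refl)
    ...   | inj₂ _ | zero = ⊥-elim (<⇒≱
              (⟦⟧-mono-< {P = λ _ → ⊥} (λ _ → no id) S? (λ _ ()) u (walk-source p) id) (≤-trans bound z≤n))
    ...   | inj₂ (w , a , q) | suc n = _ , step (walk-source p) a (proj₂ (go n S′? smaller q))
      where
      S′? = λ z → S? z ×-dec ¬? (z ≟ u)
      smaller = s≤s⁻¹ (≤-trans (⟦⟧-mono-< S′? S? (λ _ → proj₁) u (walk-source p) (λ s → proj₂ s refl)) bound)

  simple-join : ∀ {S S′ U k l u v u′ v′} → (∀ z → S z → U z) → (∀ z → S′ z → U z) → (∀ z → S z → ¬ S′ z) →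
    SimplePath S k u v → Adj T v u′ → SimplePath S′ l u′ v′ → SimplePath U (suc k + l) u v′
  simple-join f g d (here s) e q =
    step (f _ s) e (simple-mono (λ z s′ → g z s′ , λ { refl → d z s s′ }) q)
  simple-join f g d (step s a p) e q =
    step (f _ s) a (simple-join (λ { z (sz , ne) → f z sz , ne }) (λ z s′ → g z s′ , λ { refl → d z s s′ })
                                (λ z → d z ∘ proj₁) p e q)

  vertex : ∀ {S k u v} → SimplePath S k u v → Fin (suc k) → V T
  vertex {u = u} _ zero = u
  vertex (step _ _ p) (suc i) = vertex p i

  vertex-in : ∀ {S k u v} (p : SimplePath S k u v) i → S (vertex p i)
  vertex-in (here s) zero = s
  vertex-in (step s _ _) zero = s
  vertex-in (step _ _ p) (suc i) = proj₁ (vertex-in p i)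

  vertex-injective : ∀ {S k u v} (p : SimplePath S k u v) → Injective _≡_ _≡_ (vertex p)
  vertex-injective p {zero} {zero} _ = refl
  vertex-injective (step _ _ p) {zero} {suc j} e = ⊥-elim (proj₂ (vertex-in p j) (sym e))
  vertex-injective (step _ _ p) {suc i} {zero} e = ⊥-elim (proj₂ (vertex-in p i) e)
  vertex-injective (step _ _ p) {suc i} {suc j} e = cong suc (vertex-injective p e)

  vertex-adj : ∀ {S k u v} (p : SimplePath S k u v) (i : Fin k) → Adj T (vertex p (inject₁ i)) (vertex p (suc i))
  vertex-adj (step _ a p) zero = a
  vertex-adj (step _ _ p) (suc i) = vertex-adj p i

  vertex-last : ∀ {S k u v} (p : SimplePath S k u v) → vertex p (fromℕ k) ≡ v
  vertex-last (here _) = refl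
  vertex-last (step _ _ p) = vertex-last p

  closed-path⇒cycle : ∀ {S k u v} → SimplePath S (suc (suc k)) u v → Adj T v u → HasCycle T
  closed-path⇒cycle {k = k} {u} p a = k , vertex p , vertex-injective p , vertex-adj p ,
    subst (λ w → Adj T w u) (sym (vertex-last p)) a

  -- Otherwise a path from `b` to `b′` in `B`, a path from `a′` to `a` in `A` and the two edges form
  -- a cycle. It has at least three vertices even if `a` and `a′` coincide, because the path in `B`
  -- has an edge.
  unique-edge : ¬ HasCycle T → ∀ {A B} → Decidable A → Decidable B → ConnectedSet T A → ConnectedSet T B →
    (∀ t → A t → ¬ B t) → ∀ {a a′ b b′} → A a → A a′ → B b → B b′ → Adj T a b → Adj T a′ b′ → b ≡ b′
  unique-edge acyclic {A} {B} A? B? Aconn Bconn disj {a} {a′} {b} {b′} Aa Aa′ Bb Bb′ ab a′b′ =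
    decidable-stable (b ≟ b′) λ b≢b′ →
      acyclic (close b≢b′ (simplify B? (Bconn b b′ Bb Bb′)) (simplify A? (Aconn a′ a Aa′ Aa)))
    where
    close : b ≢ b′ → (∃ λ k → SimplePath B k b b′) → (∃ λ l → SimplePath A l a′ a) → HasCycle T
    close b≢b′ (zero , here _) _ = ⊥-elim (b≢b′ refl)
    close _ (suc k , p) (l , q) = closed-path⇒cycle
      (simple-join {U = λ _ → ⊤} (λ _ _ → tt) (λ _ _ → tt) (λ z bz az → disj z az bz) p (Adj-sym {G = T} a′b′) q) ab

module _ {G : Graph} where

  Region : (V G → ℕ) → V G → V G → Set
  Region key v u = WalkIn G (λ z → key v ≤ key z) v u

  Boundary⊆ : (V G → Set) → Subset (size G) → Set
  Boundary⊆ C B = ∀ u w → C w → Adj G u w → ¬ C u → u ∈ B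

  -- Vertices with smaller keys are eliminated later: Region key v is the set of descendants of v
  -- in the elimination tree, and front v bounds v together with the neighbourhood of that set.
  record EliminationOrder (τ : ℕ) : Set where
    field
      key       : V G → ℕ
      key-inj   : ∀ u v → key u ≡ key v → u ≡ v
      front     : V G → Subset (size G)
      front-≤   : ∀ v → ∣ front v ∣ ≤ τ
      own∈front : ∀ v → v ∈ front v
      boundary  : ∀ v → Boundary⊆ (Region key v) (front v)

  module _ (TD : TreeDecomposition G) where

    Trace : (V G → Set) → V (tree TD) → Set
    Trace C t = ∃ λ c → C c × c ∈ bag TD t

    -- Adjacent vertices share a bag, so a walk in `C` lifts to a walk through the subtrees of its
    -- vertices.
    trace-connected : ∀ {C} → ConnectedSet G C → ConnectedSet (tree TD) (Trace C)
    trace-connected {C} conn t t′ (c , Cc , c∈t) (c′ , Cc′ , c′∈t′) = go (conn c c′ Cc Cc′) c∈t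
      where
      within : ∀ {c t t′} → C c → c ∈ bag TD t → c ∈ bag TD t′ → WalkIn (tree TD) (Trace C) t t′
      within {c} Cc c∈t c∈t′ = walk-mono (λ z c∈z → c , Cc , c∈z) (coherent TD c _ _ c∈t c∈t′)
      go : ∀ {c t} → WalkIn G C c c′ → c ∈ bag TD t → WalkIn (tree TD) (Trace C) t t′
      go (here Cc) c∈t = within Cc c∈t c′∈t′
      go (step Cc a p) c∈t with cover-edge TD _ _ a
      ... | t₁ , c∈t₁ , w∈t₁ = walk-trans (within Cc c∈t c∈t₁) (go p w∈t₁)

    -- Moving from s towards the trace of C, every bag up to the first one that meets C keeps the boundary of C.
    gate : ∀ {C} → Decidable C → ConnectedSet G C → ∀ {c₀} → C c₀ → ∀ s → Boundary⊆ C (bag TD s) →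
           ∃ λ t → Trace C t × Boundary⊆ C (bag TD t)
    gate {C} C? conn {c₀} Cc₀ s N⊆s with any? (λ c → C? c ×-dec (c ∈? bag TD s))
    ... | yes meets = s , meets , N⊆s
    ... | no apart = next E₀ , meet E₀ , keep
      where
      open Exit
      Out : V (tree TD) → Set
      Out t = ¬ Trace C t
      Trace? : Decidable (Trace C)
      Trace? t = any? (λ c → C? c ×-dec (c ∈? bag TD t))
      Out? : Decidable Out
      Out? t = ¬? (Trace? t)
      meet : ∀ {S u v} (E : Exit {G = tree TD} S Out u v) → Trace C (next E)
      meet E = decidable-stable (Trace? _) (outside E)
      E₀ : Exit {G = tree TD} (λ _ → ⊤) Out s (proj₁ (cover-vert TD c₀))
      E₀ = first-exit Out? (proj₁ (proj₂ (isTree TD)) _ _ tt tt) apart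
             (λ out → out (c₀ , Cc₀ , proj₂ (cover-vert TD c₀)))
      side : V (tree TD) → Set
      side = WalkIn (tree TD) Out s
      keep : Boundary⊆ C (bag TD (next E₀))
      keep u w Cw a ¬Cu with cover-edge TD u w a
      ... | t , u∈t , w∈t = subst (λ z → u ∈ bag TD z) (sym same) (S-next E)
        where
        -- The subtree of `u` contains `s` and a node of the trace, hence also an entry into the
        -- trace. As the tree is acyclic, all entries from the component of `s` are the same node.
        E : Exit {G = tree TD} (λ z → u ∈ bag TD z) Out s t
        E = first-exit Out? (coherent TD u s t (N⊆s u w Cw a ¬Cu) u∈t) apart (λ out → out (w , Cw , w∈t))
        same : next E₀ ≡ next E
        same = unique-edge (proj₂ (proj₂ (isTree TD))) {A = side} {B = Trace C} (walk? Out? s) Trace?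
          (λ x y p q → walk-trans (walk-sym (walk-reach p)) (walk-reach q))
          (trace-connected conn)
          (λ t p → walk-target p)
          (walk-mono (λ _ → proj₂) (inside E₀)) (walk-mono (λ _ → proj₂) (inside E)) (meet E₀) (meet E)
          (edge E₀) (edge E)

    module _ {τ : ℕ} (width : ∀ t → ∣ bag TD t ∣ ≤ τ) where

      Reach : Subset (size G) → V G → V G → Set
      Reach R = WalkIn G (_∈ R)

      record OrderOf (R : Subset (size G)) (base : ℕ) : Set where
        field
          keyᴿ      : V G → ℕ
          keyᴿ-≥    : ∀ u → base ≤ keyᴿ u
          keyᴿ-inj  : ∀ u v → u ∈ R → v ∈ R → keyᴿ u ≡ keyᴿ v → u ≡ v
          frontᴿ    : ∀ v → v ∈ R → ∃ λ t → v ∈ bag TD t ×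
                      Boundary⊆ (WalkIn G (λ z → z ∈ R × keyᴿ v ≤ keyᴿ z) v) (bag TD t)

      -- By `gate`, the boundary of the component of `v₀` lies in a bag that also contains some `v`
      -- of this component. This `v` receives the least key and is removed: what remains of its
      -- component has its boundary in the same bag, and the other components are unaffected.
      order : ∀ k R base → ∣ R ∣ ≤ k → (∀ v → v ∈ R → ∃ λ t → Boundary⊆ (Reach R v) (bag TD t)) → OrderOf R base
      order k R base bound inv with nonempty? R
      ... | no empty = record { keyᴿ = λ _ → base ; keyᴿ-≥ = λ _ → ≤-refl
                              ; keyᴿ-inj = λ u v u∈ → ⊥-elim (empty (u , u∈))
                              ; frontᴿ = λ v v∈ → ⊥-elim (empty (v , v∈)) }
      order zero R base bound inv | yes (v₀ , v₀∈) = ⊥-elim (<⇒≱ (x∈p⇒∣p-x∣<∣p∣ v₀∈) (≤-trans bound z≤n))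
      order (suc k) R base bound inv | yes (v₀ , v₀∈)
        with gate (walk? (_∈? R) v₀) (λ x y p q → walk-trans (walk-sym (walk-reach p)) (walk-reach q))
                  (here v₀∈) _ (proj₂ (inv v₀ v₀∈))
      ... | t , (v , v₀~v , v∈t) , N⊆t = record
        { keyᴿ = key′ ; keyᴿ-≥ = key′≥ ; keyᴿ-inj = key′-inj ; frontᴿ = front′ }
        where
        v∈R : v ∈ R
        v∈R = walk-target v₀~v
        R′ = R - v
        R′⊆R : ∀ {z} → z ∈ R′ → z ∈ R
        R′⊆R = p─q⊆p R _
        v∉R′ : v ∉ R′
        v∉R′ = x∉p-x v R
        inv′ : ∀ u → u ∈ R′ → ∃ λ t → Boundary⊆ (Reach R′ u) (bag TD t)
        inv′ u u∈ with walk? (_∈? R) v₀ u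
        ... | yes v₀~u = t , N′
          where
          N′ : Boundary⊆ (Reach R′ u) (bag TD t)
          N′ x w u~w a ¬u~x with x ≟ v
          ... | yes refl = v∈t
          ... | no x≢v = N⊆t x w (walk-trans v₀~u (walk-mono (λ _ → R′⊆R) u~w)) a
                  (λ v₀~x → ¬u~x (walk-snoc u~w (Adj-sym {G = G} a) (x∈p∧x≢y⇒x∈p-y (walk-target v₀~x) x≢v)))
        ... | no v₀≁u = proj₁ (inv u (R′⊆R u∈)) , N′
          where
          N′ : Boundary⊆ (Reach R′ u) (bag TD (proj₁ (inv u (R′⊆R u∈))))
          N′ x w u~w a ¬u~x with x ≟ v
          ... | yes refl = ⊥-elim (v₀≁u (walk-trans (walk-snoc v₀~v a (R′⊆R (walk-target u~w)))
                                          (walk-sym (walk-mono (λ _ → R′⊆R) u~w))))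
          ... | no x≢v = proj₂ (inv u (R′⊆R u∈)) x w (walk-mono (λ _ → R′⊆R) u~w) a
                  (λ u~x → ¬u~x (walk-snoc u~w (Adj-sym {G = G} a) (x∈p∧x≢y⇒x∈p-y (walk-target u~x) x≢v)))
        rec : OrderOf R′ (suc base)
        rec = order k R′ (suc base) (s≤s⁻¹ (≤-trans (x∈p⇒∣p-x∣<∣p∣ v∈R) bound)) inv′
        open OrderOf rec
        key′ : V G → ℕ
        key′ u with u ≟ v
        ... | yes _ = base
        ... | no _ = keyᴿ u
        key′≥ : ∀ u → base ≤ key′ u
        key′≥ u with u ≟ v
        ... | yes _ = ≤-refl
        ... | no _ = <⇒≤ (keyᴿ-≥ u)
        key′-inj : ∀ x y → x ∈ R → y ∈ R → key′ x ≡ key′ y → x ≡ y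
        key′-inj x y x∈ y∈ e with x ≟ v | y ≟ v
        ... | yes refl | yes refl = refl
        ... | yes refl | no y≢v = ⊥-elim (<-irrefl e (keyᴿ-≥ y))
        ... | no x≢v | yes refl = ⊥-elim (<-irrefl (sym e) (keyᴿ-≥ x))
        ... | no x≢v | no y≢v = keyᴿ-inj x y (x∈p∧x≢y⇒x∈p-y x∈ x≢v) (x∈p∧x≢y⇒x∈p-y y∈ y≢v) e
        front′ : ∀ x → x ∈ R → ∃ λ t → x ∈ bag TD t ×
                 Boundary⊆ (WalkIn G (λ z → z ∈ R × key′ x ≤ key′ z) x) (bag TD t)
        front′ x x∈ with x ≟ v
        ... | yes refl = t , v∈t , λ u w v~w a ¬v~u → N⊆t u w
                (walk-trans v₀~v (walk-mono (λ _ → proj₁) v~w)) a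
                (λ v₀~u → ¬v~u (walk-snoc v~w (Adj-sym {G = G} a)
                  (walk-target v₀~u , key′≥ u)))
        ... | no x≢v with frontᴿ x (x∈p∧x≢y⇒x∈p-y x∈ x≢v)
        ...   | t₁ , x∈t₁ , N = t₁ , x∈t₁ , λ u w x~w a ¬x~u → N u w (walk-mono to x~w) a (¬x~u ∘ walk-mono from)
          where
          -- The key of `v` is smaller than all others, so the region of any other vertex avoids `v`
          -- and is the same in `R` and `R′`.
          from : ∀ z → z ∈ R′ × keyᴿ x ≤ keyᴿ z → z ∈ R × keyᴿ x ≤ key′ z
          from z (z∈ , le) with z ≟ v
          ... | yes refl = ⊥-elim (v∉R′ z∈)
          ... | no _ = R′⊆R z∈ , le
          to : ∀ z → z ∈ R × keyᴿ x ≤ key′ z → z ∈ R′ × keyᴿ x ≤ keyᴿ z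
          to z (z∈ , le) with z ≟ v
          ... | yes refl = ⊥-elim (<⇒≱ (keyᴿ-≥ x) le)
          ... | no z≢v = x∈p∧x≢y⇒x∈p-y z∈ z≢v , le

      eliminationOrder : V (tree TD) → EliminationOrder τ
      eliminationOrder t₀ = record
        { key = keyᴿ
        ; key-inj = λ u v → keyᴿ-inj u v ∈⊤ ∈⊤
        ; front = λ v → bag TD (proj₁ (frontᴿ v ∈⊤))
        ; front-≤ = λ v → width _
        ; own∈front = λ v → proj₁ (proj₂ (frontᴿ v ∈⊤))
        ; boundary = λ v u w v~w a ¬v~u → proj₂ (proj₂ (frontᴿ v ∈⊤)) u w
            (walk-mono (λ _ le → ∈⊤ , le) v~w) a (¬v~u ∘ walk-mono (λ _ → proj₂)) }
        where
        open OrderOf (order (size G) Sub.⊤ 0 (∣p∣≤n Sub.⊤)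
          -- Components of the whole graph have an empty boundary, so any node serves at the start.
          (λ v _ → t₀ , λ u w v~w a ¬v~u → ⊥-elim (¬v~u (walk-snoc v~w (Adj-sym {G = G} a) ∈⊤))))

-- Heavy regions and pathwidth

module _ {G : Graph} {τ : ℕ} (E : EliminationOrder {G} τ) where
  open EliminationOrder E

  D : V G → V G → Set
  D = Region {G = G} key

  D? : ∀ v → Decidable (D v)
  D? v = walk? (λ z → key v ℕ.≤? key z) v

  D-refl : ∀ {v} → D v v
  D-refl = here ≤-refl

  D-key : ∀ {v u} → D v u → key v ≤ key u
  D-key = walk-target

  D-trans : ∀ {v u w} → D v u → D u w → D v w
  D-trans p q = walk-trans p (walk-mono (λ _ → ≤-trans (D-key p)) q)

  D-key-≡ : ∀ {v u} → D v u → key u ≤ key v → u ≡ v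
  D-key-≡ p le = key-inj _ _ (≤-antisym le (D-key p))

  D-meet≤ : ∀ {u v z} → key u ≤ key v → D u z → D v z → D u v
  D-meet≤ le p q = walk-trans p (walk-sym (walk-mono (λ _ → ≤-trans le) q))

  -- Regions form a laminar family; `D-near` adds that incomparable regions are not even adjacent.
  D-meet : ∀ {u v z} → D u z → D v z → D u v ⊎ D v u
  D-meet {u} {v} p q with ≤-total (key u) (key v)
  ... | inj₁ le = inj₁ (D-meet≤ le p q)
  ... | inj₂ ge = inj₂ (D-meet≤ ge q p)

  D-adj : ∀ {u v} → Adj G u v → D u v ⊎ D v u
  D-adj {u} {v} a with ≤-total (key u) (key v)
  ... | inj₁ le = inj₁ (step ≤-refl a (here le))
  ... | inj₂ ge = inj₂ (step ≤-refl (Adj-sym {G = G} a) (here ge))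

  D-near : ∀ {u v a b} → D u a → D v b → Adj G a b → D u v ⊎ D v u
  D-near p q e with D-adj e
  ... | inj₁ ab = D-meet (D-trans p ab) q
  ... | inj₂ ba = D-meet p (D-trans q ba)

  D-connected : ∀ v → ConnectedSet G (D v)
  D-connected v a b p q = walk-trans (walk-sym (walk-reach p)) (walk-reach q)

  _∖_ : (V G → Set) → (V G → Set) → V G → Set
  (P ∖ Q) z = P z × ¬ Q z

  Fork : (V G → Set) → V G → V G → V G → V G → Set
  Fork P x e w₁ w₂ = P w₁ × P w₂ × WalkIn G (D x ∖ D w₂) e w₁ × WalkIn G (D x ∖ D w₁) e w₂

  -- A fork is demanded at every `e`, since a region may be entered at any of its vertices; a
  -- failure supplies one `e` to sweep from.
  Heavy : ℕ → V G → Set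
  Heavy zero x = ⊤
  Heavy (suc r) x = ∀ e → D x e → ∃ λ w₁ → ∃ λ w₂ → Fork (Heavy r) x e w₁ w₂

  Fork? : ∀ {P} → Decidable P → ∀ x e w₁ w₂ → Dec (Fork P x e w₁ w₂)
  Fork? P? x e w₁ w₂ = P? w₁ ×-dec (P? w₂ ×-dec
    (walk? (λ z → D? x z ×-dec ¬? (D? w₂ z)) e w₁ ×-dec walk? (λ z → D? x z ×-dec ¬? (D? w₁ z)) e w₂))

  Heavy? : ∀ r → Decidable (Heavy r)
  Heavy? zero x = yes tt
  Heavy? (suc r) x = all? λ e → D? x e →-dec any? λ w₁ → any? λ w₂ → Fork? (Heavy? r) x e w₁ w₂

  -- Lays out the ancestors of `w` at the cost of one front. Vertices are layered by their deepest
  -- common ancestor with `w`, and layer `c` keeps the front of the highest ancestor of `w` that is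
  -- at least as deep as `c`. An edge into a deeper layer starts at an ancestor of `w`, and this
  -- ancestor is in all the fronts kept in between.
  peel : ∀ {Y m} w → Layout {G} (λ u → Y u × ¬ D u w) m → Layout {G} Y (m + τ)
  peel {Y} {m} w L = layered depth B ∣B∣≤τ crossing (λ c → layout-⊆ (off-chain c) L)
    where
    Common? : ∀ u → Decidable (λ a → D a u × D a w)
    Common? u a = D? a u ×-dec D? a w
    -- The shift by `suc` reserves 0 for vertices that have no common ancestor with `w`.
    depth : V G → ℕ
    depth u = proj₁ (maximum (Common? u) (suc ∘ key))
    depth-≥ : ∀ u a → D a u → D a w → suc (key a) ≤ depth u
    depth-≥ u a p q = proj₁ (proj₂ (maximum (Common? u) (suc ∘ key))) a (p , q)
    depth-attained : ∀ u → 0 < depth u → ∃ λ a → (D a u × D a w) × suc (key a) ≡ depth u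
    depth-attained u pos with maximum (Common? u) (suc ∘ key)
    ... | m , _ , inj₂ att = att
    depth-attained u () | .0 , _ , inj₁ refl
    Deep : ℕ → V G → Set
    Deep c a = D a w × c ≤ suc (key a)
    Deep? : ∀ c → Decidable (Deep c)
    Deep? c a = D? a w ×-dec (c ℕ.≤? suc (key a))
    top : ∀ c → Dec (∃ (Deep c)) → Subset (size G)
    top c (yes found) = front (proj₁ (argmin (Deep? c) key found))
    top c (no _) = Sub.⊥
    B : ℕ → Subset (size G)
    B c = top c (any? (Deep? c))
    ∣B∣≤τ : ∀ c → ∣ B c ∣ ≤ τ
    ∣B∣≤τ c with any? (Deep? c)
    ... | yes found = front-≤ _
    ... | no _ = subst (_≤ τ) (sym (∣⊥∣≡0 (size G))) z≤n
    ∈B : ∀ c {a₀} u → Deep c a₀ → (∀ a → Deep c a → (∀ b → Deep c b → key a ≤ key b) → u ∈ front a) → u ∈ B c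
    ∈B c {a₀} u deep in-front with any? (Deep? c)
    ... | no none = ⊥-elim (none (a₀ , deep))
    ... | yes found with argmin (Deep? c) key found
    ...   | a , da , least = in-front a da least
    crossing : ∀ u v → Y u → Y v → Adj G u v → depth u < depth v → ∀ c → depth u ≤ c → c ≤ depth v → u ∈ B c
    crossing u v _ _ uv lt c du≤c c≤dv with depth-attained v (≤-<-trans z≤n lt)
    ... | a , (a-v , a-w) , ka≡ = ∈B c u deep-a in-front
      where
      deep-a : Deep c a
      deep-a = a-w , subst (c ≤_) (sym ka≡) c≤dv
      a≁u : ¬ D a u
      a≁u a-u = <⇒≱ lt (subst (_≤ depth u) ka≡ (depth-≥ u a a-u a-w))
      u-w : D u w
      u-w with D-adj uv
      ... | inj₂ v-u = ⊥-elim (a≁u (D-trans a-v v-u))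
      ... | inj₁ u-v with D-meet u-v a-v
      ...   | inj₁ u-a = D-trans u-a a-w
      ...   | inj₂ a-u = ⊥-elim (a≁u a-u)
      in-front : ∀ b → Deep c b → (∀ b′ → Deep c b′ → key b ≤ key b′) → u ∈ front b
      in-front b (b-w , c≤b) least with D? b u
      ... | no b≁u = boundary b u v (D-trans (D-meet≤ (least a deep-a) b-w a-w) a-v) uv b≁u
      -- Comparing depths forces `u` to be the ancestor `b` itself.
      ... | yes b-u = subst (_∈ front b) (sym (D-key-≡ b-u
                (s≤s⁻¹ (≤-trans (depth-≥ u u D-refl u-w) (≤-trans du≤c c≤b))))) (own∈front b)
    off-chain : ∀ c u → Y u × depth u ≡ c × u ∉ B c → Y u × ¬ D u w
    off-chain c u (yu , refl , u∉) = yu , λ u-w → u∉ (∈B c u (deep u-w) (λ b → in-front u-w b))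
      where
      deep : D u w → Deep (depth u) u
      deep u-w with depth-attained u (≤-<-trans z≤n (depth-≥ u u D-refl u-w))
      ... | a , (a-u , _) , eq = u-w , subst (_≤ suc (key u)) eq (s≤s (D-key a-u))
      in-front : D u w → ∀ b → Deep (depth u) b → (∀ b′ → Deep (depth u) b′ → key b ≤ key b′) → u ∈ front b
      in-front u-w b (b-w , c≤b) least = subst (_∈ front b)
        (key-inj b u (≤-antisym (least u (deep u-w)) (s≤s⁻¹ (≤-trans (depth-≥ u u D-refl u-w) c≤b)))) (own∈front b)

  empty-layout : ∀ {Y m} → (∀ u → ¬ Y u) → Layout {G} Y m
  empty-layout {m = m} none = record
    { pos = λ _ → 0 ; bagᴸ = λ _ → Sub.⊥ ; bag-size = λ _ → subst (_≤ m) (sym (∣⊥∣≡0 (size G))) z≤n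
    ; bag-⊇ = λ i u b → ⊥-elim (none u (proj₁ b)) }

  -- The maximal regions among those rooted in P are pairwise non-adjacent.
  forest-layout : ∀ {P Y : V G → Set} {m} → Decidable P → (∀ u → Y u → P u) →
                  (∀ v → P v → Layout {G} (D v) m) → Layout {G} Y m
  forest-layout {P} {Y} {m} P? Y⊆P L = layout-≤ (≤-reflexive (+-identityʳ m))
    (layered {b = 0} o (λ _ → Sub.⊥) (λ _ → ≤-reflexive (∣⊥∣≡0 (size G))) crossing layer)
    where
    Cand : V G → V G → Set
    Cand u a = D a u × P a
    Cand? : ∀ u → Decidable (Cand u)
    Cand? u a = D? a u ×-dec P? a
    Top : V G → V G → Set
    Top u a = Cand u a × (∀ b → Cand u b → key a ≤ key b)
    Top-≡ : ∀ {u v a b} → D u v → Top u a → Top v b → a ≡ b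
    Top-≡ {u} {v} {a} {b} u-v ((a-u , Pa) , a-least) ((b-v , Pb) , b-least) =
      key-inj a b (≤-antisym (a-least b (D-trans b-a a-u , Pb)) b≤a)
      where
      b≤a : key b ≤ key a
      b≤a = b-least a (D-trans a-u u-v , Pa)
      b-a : D b a
      b-a = D-meet≤ b≤a b-v (D-trans a-u u-v)
    -- A layer is the index of a topmost ancestor in `P`; any order of the layers will do, since no
    -- edge joins two of them. Outside `P`, and hence outside `Y`, the value defaults to 0.
    o′ : ∀ u → Dec (P u) → ℕ
    o′ u (yes Pu) = toℕ (proj₁ (argmin (Cand? u) key (u , D-refl , Pu)))
    o′ u (no _) = 0
    o : V G → ℕ
    o u = o′ u (P? u)
    o-top : ∀ u → Y u → ∃ λ a → Top u a × o u ≡ toℕ a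
    o-top u yu with P? u
    ... | no ¬Pu = ⊥-elim (¬Pu (Y⊆P u yu))
    ... | yes Pu = _ , proj₂ (argmin (Cand? u) key (u , D-refl , Pu)) , refl
    crossing : ∀ u v → Y u → Y v → Adj G u v → o u < o v → ∀ c → o u ≤ c → c ≤ o v → u ∈ Sub.⊥
    crossing u v yu yv uv lt with o-top u yu | o-top v yv | D-adj uv
    ... | a , ta , ea | b , tb , eb | inj₁ u-v =
      ⊥-elim (<-irrefl (trans ea (trans (cong toℕ (Top-≡ u-v ta tb)) (sym eb))) lt)
    ... | a , ta , ea | b , tb , eb | inj₂ v-u =
      ⊥-elim (<-irrefl (trans ea (trans (cong toℕ (sym (Top-≡ v-u tb ta))) (sym eb))) lt)
    layer : ∀ c → Layout {G} (λ u → Y u × o u ≡ c × u ∉ Sub.⊥) m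
    layer c with any? (λ a → P? a ×-dec (toℕ a ℕ.≟ c))
    ... | no none = empty-layout λ { u (yu , e , _) → none (proj₁ (o-top u yu)
                      , proj₂ (proj₁ (proj₁ (proj₂ (o-top u yu)))) , trans (sym (proj₂ (proj₂ (o-top u yu)))) e) }
    ... | yes (a , Pa , refl) = layout-⊆ inside-top (L a Pa)
      where
      inside-top : ∀ u → Y u × o u ≡ toℕ a × u ∉ Sub.⊥ → D a u
      inside-top u (yu , e , _) with o-top u yu
      ... | b , tb , eb = subst (λ z → D z u) (toℕ-injective (trans (sym eb) e)) (proj₁ (proj₁ tb))

  -- Without a fork at e, of any two minimal heavy regions missing e exactly one separates the other from e.
  -- Hence the components U w of e in D x minus D w form a chain; its successive differences are the layers.
  module Light {r x e} (x-e : D x e) (no-fork : ∀ w₁ w₂ → ¬ Fork (Heavy r) x e w₁ w₂) where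

    M : V G → Set
    M w = D x w × Heavy r w × ¬ D w e × (∀ w′ → D w w′ → Heavy r w′ → w′ ≡ w)

    M? : Decidable M
    M? w = D? x w ×-dec (Heavy? r w ×-dec (¬? (D? w e) ×-dec
           all? (λ w′ → D? w w′ →-dec (Heavy? r w′ →-dec (w′ ≟ w)))))

    U : V G → V G → Set
    U w = WalkIn G (D x ∖ D w) e

    U? : ∀ w → Decidable (U w)
    U? w = walk? (λ z → D? x z ×-dec ¬? (D? w z)) e

    -- Sizes grow strictly along the chain of the sets `U w`, so they encode its linear order by
    -- numbers.
    rank : V G → ℕ
    rank w = ∣ ⟦ U? w ⟧ ∣

    M-disjoint : ∀ {w w′} → M w → M w′ → w ≢ w′ → ∀ {z} → D w z → ¬ D w′ z
    M-disjoint (_ , h , _ , least) (_ , h′ , _ , least′) w≢w′ p q with D-meet p q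
    ... | inj₁ w-w′ = w≢w′ (sym (least _ w-w′ h′))
    ... | inj₂ w′-w = w≢w′ (least′ _ w′-w h)

    -- The two walks would form a fork at `e`.
    U-asym : ∀ {w w′} → M w → M w′ → U w w′ → ¬ U w′ w
    U-asym (_ , h , _) (_ , h′ , _) p q = no-fork _ _ (h , h′ , q , p)

    -- D w is connected and avoids D w′.
    U-extend : ∀ {w w′} → M w → M w′ → w ≢ w′ → ∀ {a b} → D w a → D w b → U w′ a → U w′ b
    U-extend {w} Mw Mw′ w≢w′ w-a w-b p = walk-trans p
      (walk-mono (λ z w-z → D-trans (proj₁ Mw) w-z , M-disjoint Mw Mw′ w≢w′ w-z) (D-connected w _ _ w-a w-b))

    -- Follow a walk from `e` until it first enters one of the two regions: that region is reached
    -- while the other is avoided.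
    U-total : ∀ {w w′} → M w → M w′ → w ≢ w′ → U w w′ ⊎ U w′ w
    U-total {w} {w′} Mw Mw′ w≢w′ = leave (D? w (next X))
      where
      open Exit
      X : Exit {G = G} (D x) (λ z → ¬ D w z × ¬ D w′ z) e w
      X = first-exit (λ z → ¬? (D? w z) ×-dec ¬? (D? w′ z)) (D-connected x e w x-e (proj₁ Mw))
            (proj₁ (proj₂ (proj₂ Mw)) , proj₁ (proj₂ (proj₂ Mw′))) (λ out → proj₁ out D-refl)
      leave : Dec (D w (next X)) → U w w′ ⊎ U w′ w
      leave (yes w-n) = inj₂ (U-extend Mw Mw′ w≢w′ w-n D-refl
        (walk-snoc (walk-mono (λ { z (x-z , _ , out) → x-z , out }) (inside X)) (edge X)
                   (S-next X , M-disjoint Mw Mw′ w≢w′ w-n)))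
      leave (no w≁n) = inj₁ (U-extend Mw′ Mw (w≢w′ ∘ sym) w′-n D-refl
        (walk-snoc (walk-mono (λ { z (x-z , out , _) → x-z , out }) (inside X)) (edge X) (S-next X , w≁n)))
        where
        w′-n : D w′ (next X)
        w′-n = decidable-stable (D? w′ (next X)) (λ out → outside X (w≁n , out))

    -- If `U w` met the region of `w′`, it would extend through this connected region to `w′`,
    -- against `U-asym`.
    U-nested : ∀ {w w′} → M w → M w′ → w ≢ w′ → U w′ w → ∀ u → U w u → U w′ u
    U-nested {w} {w′} Mw Mw′ w≢w′ p u q = walk-mono
      (λ z Uz → proj₁ (walk-target Uz) , λ w′-z → U-asym Mw Mw′ (U-extend Mw′ Mw (w≢w′ ∘ sym) w′-z D-refl Uz) p)
      (walk-reach q)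

    U-irrefl : ∀ {w} → ¬ U w w
    U-irrefl p = proj₂ (walk-target p) D-refl

    U⇒rank< : ∀ {w w′} → M w → M w′ → U w′ w → rank w < rank w′
    U⇒rank< {w} {w′} Mw Mw′ p = ⟦⟧-mono-< (U? w) (U? w′) (U-nested Mw Mw′ w≢w′ p) w p U-irrefl
      where
      w≢w′ : w ≢ w′
      w≢w′ refl = U-irrefl p

    rank<⇒U : ∀ {w w′} → M w → M w′ → rank w < rank w′ → U w′ w
    rank<⇒U {w} {w′} Mw Mw′ lt with U-total Mw Mw′ (λ { refl → <-irrefl refl lt })
    ... | inj₁ p = ⊥-elim (<-asym lt (U⇒rank< Mw′ Mw p))
    ... | inj₂ p = p

    rank-inj : ∀ {w w′} → M w → M w′ → rank w ≡ rank w′ → w ≡ w′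
    rank-inj {w} {w′} Mw Mw′ eq = decidable-stable (w ≟ w′) λ w≢w′ → differ (U-total Mw Mw′ w≢w′)
      where
      differ : U w w′ ⊎ U w′ w → ⊥
      differ (inj₁ p) = <-irrefl (sym eq) (U⇒rank< Mw′ Mw p)
      differ (inj₂ p) = <-irrefl eq (U⇒rank< Mw Mw′ p)

    -- `U w` contains `e`, so 0 stays free as the level of vertices that lie in every `U w`.
    rank-pos : ∀ {w} → M w → 0 < rank w
    rank-pos {w} Mw = ≤-<-trans z≤n (⟦⟧-mono-< {P = λ _ → ⊥} (λ _ → no id) (U? w) (λ _ ()) e
                        (here (x-e , proj₁ (proj₂ (proj₂ Mw)))) id)

    U-leave : ∀ {w u v} → U w u → Adj G u v → D x v → ¬ U w v → D w v
    U-leave {w} {u} {v} p uv x-v ¬Uv = decidable-stable (D? w v) (λ w≁v → ¬Uv (walk-snoc p uv (x-v , w≁v)))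

    -- A walk in the region of `v` can leave `U w` only into the region of `w`, so the two regions
    -- meet and are nested.
    U-separates : ∀ {w v a b} → D x v → D v a → D v b → U w a → ¬ U w b → D v w ⊎ D w v
    U-separates {w} {v} {a} {b} x-v v-a v-b Ua ¬Ub =
      D-meet (S-next X) (U-leave (proj₂ (walk-target (inside X))) (edge X) (D-trans x-v (S-next X)) (outside X))
      where
      open Exit
      X : Exit {G = G} (D v) (U w) a b
      X = first-exit (U? w) (D-connected v a b v-a v-b) Ua ¬Ub

    Behind? : ∀ u → Decidable (λ w → M w × ¬ U w u)
    Behind? u w = M? w ×-dec ¬? (U? w u)

    level : V G → ℕ
    level u = proj₁ (maximum (Behind? u) rank)

    level-≥ : ∀ {u w} → M w → ¬ U w u → rank w ≤ level u
    level-≥ {u} {w} Mw ¬Uu = proj₁ (proj₂ (maximum (Behind? u) rank)) w (Mw , ¬Uu)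

    level-attained : ∀ u → 0 < level u → ∃ λ w → (M w × ¬ U w u) × rank w ≡ level u
    level-attained u pos with maximum (Behind? u) rank
    ... | m , _ , inj₂ att = att
    level-attained u () | .0 , _ , inj₁ refl

    U-above : ∀ {u w} → M w → level u < rank w → U w u
    U-above {u} {w} Mw lt = decidable-stable (U? w u) (λ ¬Uu → <⇒≱ lt (level-≥ Mw ¬Uu))

    At? : ∀ c → Decidable (λ w → M w × rank w ≡ c)
    At? c w = M? w ×-dec (rank w ℕ.≟ c)

    Above : ℕ → V G → Set
    Above c w = M w × c < rank w

    Above? : ∀ c → Decidable (Above c)
    Above? c w = M? w ×-dec (c ℕ.<? rank w)

    -- Both default to the irrelevant vertex e.
    pred succ : ℕ → V G
    pred c with any? (At? c)
    ... | yes (w , _) = w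
    ... | no _ = e
    succ c with any? (Above? c)
    ... | yes found = proj₁ (argmin (Above? c) rank found)
    ... | no _ = e

    pred-≡ : ∀ {c w} → M w → rank w ≡ c → pred c ≡ w
    pred-≡ {c} {w} Mw eq with any? (At? c)
    ... | yes (w′ , Mw′ , eq′) = rank-inj Mw′ Mw (trans eq′ (sym eq))
    ... | no none = ⊥-elim (none (w , Mw , eq))

    succ-least : ∀ {c w} → M w → c < rank w → Above c (succ c) × (∀ w′ → Above c w′ → rank (succ c) ≤ rank w′)
    succ-least {c} {w} Mw lt with any? (Above? c)
    ... | yes found = proj₂ (argmin (Above? c) rank found)
    ... | no none = ⊥-elim (none (w , Mw , lt))

    B : ℕ → Subset (size G)
    B c = front (pred c) ∪ front (succ c)

    ∣B∣≤ : ∀ c → ∣ B c ∣ ≤ τ + τ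
    ∣B∣≤ c = ≤-trans (∣∪∣≤ (front (pred c)) (front (succ c))) (+-mono-≤ (front-≤ _) (front-≤ _))

    -- Such an edge enters the region of the `w` with rank `level v`, so `u` is in its front. No
    -- region is skipped: if `succ c` came before `w`, its region would contain `v` too, against
    -- disjointness.
    crossing : ∀ u v → D x u → D x v → Adj G u v → level u < level v →
               ∀ c → level u ≤ c → c ≤ level v → u ∈ B c
    crossing u v x-u x-v uv lt c u≤c c≤v with level-attained v (≤-<-trans z≤n lt)
    ... | w , (Mw , ¬Uv) , rw = locate (m≤n⇒m<n∨m≡n c≤v)
      where
      Uu : U w u
      Uu = U-above Mw (subst (level u <_) (sym rw) lt)
      w-v : D w v
      w-v = U-leave Uu uv x-v ¬Uv
      u∈w : u ∈ front w
      u∈w = boundary w u v w-v uv (proj₂ (walk-target Uu))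
      locate : c < level v ⊎ c ≡ level v → u ∈ B c
      locate (inj₂ c≡) = p⊆p∪q _ (subst (λ z → u ∈ front z) (sym (pred-≡ Mw (trans rw (sym c≡)))) u∈w)
      locate (inj₁ c<) = q⊆p∪q _ _ (subst (λ z → u ∈ front z) (sym s≡w) u∈w)
        where
        c<rw : c < rank w
        c<rw = subst (c <_) (sym rw) c<
        s = succ c
        Ms : M s
        Ms = proj₁ (proj₁ (succ-least Mw c<rw))
        c<s : c < rank s
        c<s = proj₂ (proj₁ (succ-least Mw c<rw))
        s≤w : rank s ≤ rank w
        s≤w = proj₂ (succ-least Mw c<rw) w (Mw , c<rw)
        s≡w : s ≡ w
        s≡w = decidable-stable (s ≟ w) λ s≢w →
          let w~s = rank<⇒U Ms Mw (≤∧≢⇒< s≤w (s≢w ∘ rank-inj Ms Mw))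
              Us-u = U-above Ms (≤-<-trans u≤c c<s)
              ¬Us-v = λ Us-v → U-asym Mw Ms w~s (U-extend Mw Ms (s≢w ∘ sym) w-v D-refl Us-v)
          in M-disjoint Ms Mw s≢w (U-leave Us-u uv x-v ¬Us-v) w-v

    -- A heavy region of `v` contains some `w` in `M`. If its rank exceeds `c`, then `U (succ c)`
    -- separates `v` from `w`, otherwise `U (pred c)` does. By `U-separates` the region of `v` is
    -- then nested with that of `succ c` or `pred c`; one direction is excluded by assumption, the
    -- other by minimality.
    light : ∀ c v → D x v → level v ≡ c → ¬ D v e → ¬ D v (pred c) → ¬ D v (succ c) → ¬ Heavy r v
    light c v x-v lv v≁e v≁p v≁s h = split (c ℕ.<? rank w)
      where
      HeavyIn? : Decidable (λ w → D v w × Heavy r w)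
      HeavyIn? w = D? v w ×-dec Heavy? r w
      -- A largest key makes the heavy region inclusion-minimal.
      deepest = argmax HeavyIn? key (v , D-refl , h)
      w = proj₁ deepest
      v-w : D v w
      v-w = proj₁ (proj₁ (proj₂ deepest))
      Mw : M w
      Mw = D-trans x-v v-w , proj₂ (proj₁ (proj₂ deepest)) , (λ w-e → v≁e (D-trans v-w w-e))
         , λ w′ w-w′ h′ → D-key-≡ w-w′ (proj₂ (proj₂ deepest) w′ (D-trans v-w w-w′ , h′))
      incomparable : ∀ {s} → M s → ¬ D v s → ¬ (D v s ⊎ D s v)
      incomparable Ms v≁s (inj₁ v-s) = v≁s v-s
      incomparable (_ , _ , _ , least) v≁s (inj₂ s-v) = v≁s (subst (D v) (least v s-v h) D-refl)
      split : Dec (c < rank w) → ⊥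
      split (yes c<w) = incomparable Ms v≁s (U-separates x-v D-refl v-w Us-v (U-asym Mw Ms w~s))
        where
        s = succ c
        Ms : M s
        Ms = proj₁ (proj₁ (succ-least Mw c<w))
        Us-v : U s v
        Us-v = U-above Ms (subst (_< rank s) (sym lv) (proj₂ (proj₁ (succ-least Mw c<w))))
        s≢w : s ≢ w
        s≢w eq = v≁s (subst (D v) (sym eq) v-w)
        w~s : U w s
        w~s = rank<⇒U Ms Mw (≤∧≢⇒< (proj₂ (succ-least Mw c<w) w (Mw , c<w)) (s≢w ∘ rank-inj Ms Mw))
      split (no c≮w) with level-attained v (subst (0 <_) (sym lv) (<-≤-trans (rank-pos Mw) (≮⇒≥ c≮w)))
      ... | p , (Mp , ¬Up-v) , rp = incomparable Mp v≁p′ (U-separates x-v v-w D-refl Up-w ¬Up-v)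
        where
        rp≡c : rank p ≡ c
        rp≡c = trans rp lv
        v≁p′ : ¬ D v p
        v≁p′ = v≁p ∘ subst (D v) (sym (pred-≡ Mp rp≡c))
        p≢w : w ≢ p
        p≢w eq = v≁p′ (subst (D v) eq v-w)
        Up-w : U p w
        Up-w = rank<⇒U Mw Mp (≤∧≢⇒< (subst (rank w ≤_) (sym rp≡c) (≮⇒≥ c≮w)) (p≢w ∘ rank-inj Mw Mp))

    -- One `τ` each pays for peeling the ancestors of `succ c`, `pred c` and `e`, and two more pay
    -- for the fronts in `B c`.
    light-layout : ∀ {m} → (∀ {Y} → (∀ u → Y u → ¬ Heavy r u) → Layout {G} Y m) → Layout {G} (D x) (m + τ + τ + τ + (τ + τ))
    light-layout L = layered level B ∣B∣≤ crossing λ c → peel e (peel (pred c) (peel (succ c)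
      (L λ { u ((((x-u , lu , _) , u≁e) , u≁p) , u≁s) → light c u x-u lu u≁e u≁p u≁s })))

  layout-light-region : ∀ r x → ¬ Heavy r x → Layout {G} (D x) (r * (5 * τ))
  layout-light : ∀ r {Y} → (∀ u → Y u → ¬ Heavy r u) → Layout {G} Y (r * (5 * τ))

  layout-light r light = forest-layout (λ u → ¬? (Heavy? r u)) light (layout-light-region r)

  layout-light-region zero x ¬h = ⊥-elim (¬h tt)
  layout-light-region (suc r) x ¬h
    with ¬∀→∃ (D? x) (λ e → any? λ w₁ → any? λ w₂ → Fork? (Heavy? r) x e w₁ w₂) ¬h
  ... | e , x-e , no-fork = layout-≤ (≤-reflexive (rearrange (r * (5 * τ)) τ))
          (Light.light-layout x-e (λ w₁ w₂ f → no-fork (w₁ , w₂ , f)) (layout-light r))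
    where
    rearrange : ∀ a t → a + t + t + t + (t + t) ≡ 5 * t + a
    rearrange = solve 2 (λ a t → a :+ t :+ t :+ t :+ (t :+ t) := con 5 :* t :+ a) refl
      where open +-*-Solver

-- Heavy regions and binary trees

-- The geometric sum τ + τ² + ... + τ^d. The factor `τ` counts the steps of `descend` in
-- `dense⇒good`; each must provide `Δ τ d` for the recursion and one degree for a fork.
Δ : ℕ → ℕ → ℕ
Δ τ zero = 0
Δ τ (suc d) = τ * suc (Δ τ d)

Link : List Bool → List Bool → Set
Link p q = (∃ λ b → q ≡ p ∷ʳ b) ⊎ (∃ λ b → p ≡ q ∷ʳ b)

link-∷ : ∀ b {p q} → Link p q → Link (b ∷ p) (b ∷ q)
link-∷ b (inj₁ (c , refl)) = inj₁ (c , refl)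
link-∷ b (inj₂ (c , refl)) = inj₂ (c , refl)

-- Vertices of the binary tree are the lists of turns on the way from the root.
record RootedModel (G : Graph) (j : ℕ) (X : V G → Set) (e : V G) (P : V G → Set) : Set₁ where
  field
    branchᴿ    : List Bool → V G → Set
    within     : ∀ p v → branchᴿ p v → X v
    root∋      : branchᴿ [] e
    nonemptyᴿ  : ∀ p → length p ≤ j → ∃ (branchᴿ p)
    connectedᴿ : ∀ p → ConnectedSet G (branchᴿ p)
    disjointᴿ  : ∀ p q → p ≢ q → ∀ v → branchᴿ p v → ¬ branchᴿ q v
    linked     : ∀ p q → p ≢ q → ∀ {u v} → branchᴿ p u → branchᴿ q v → Adj G u v → Link p q
    joined     : ∀ p b → length p < j → ∃ λ u → ∃ λ v → branchᴿ p u × branchᴿ (p ∷ʳ b) v × Adj G u v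
    avoids     : ∀ p → p ≢ [] → ∀ {u v} → P u → branchᴿ p v → ¬ Adj G u v

module _ {G : Graph} {τ : ℕ} (E : EliminationOrder {G} τ) where
  open EliminationOrder E

  private
    infix 4 _⊒_
    _⊒_ : V G → V G → Set
    _⊒_ = D E

  -- The obstruction to `v` as a prong below `u`: branch sets inside its region might see vertices
  -- beyond `u`.
  Hit : V G → V G → V G → Set
  Hit v u y = ∃ λ p → ∃ λ q → (y ⊒ p) × ¬ (u ⊒ p) × (v ⊒ q) × Adj G p q

  Hit? : ∀ v u y → Dec (Hit v u y)
  Hit? v u y = any? λ p → any? λ q → D? E y p ×-dec (¬? (D? E u p) ×-dec (D? E v q ×-dec Adj? {G = G} p q))

  -- The last argument is the surrounding region, whose part outside the region of `u` must not be
  -- seen by the prongs. One level down, `u` takes over this role.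
  Good : ℕ → V G → V G → Set
  Good zero u y = ⊤
  Good (suc j) u y = ∀ e → u ⊒ e → ∃ λ v₁ → ∃ λ v₂ → Fork E (λ v → Good j v u × ¬ Hit v u y) u e v₁ v₂

  Good? : ∀ j u y → Dec (Good j u y)
  Good? zero u y = yes tt
  Good? (suc j) u y = all? λ e → D? E u e →-dec any? λ v₁ → any? λ v₂ →
    Fork? E (λ v → Good? j v u ×-dec ¬? (Hit? v u y)) u e v₁ v₂

  Good-mono : ∀ j {u y y′} → y ⊒ y′ → Good j u y → Good j u y′
  Good-mono zero _ _ = tt
  Good-mono (suc j) y-y′ good e u-e with good e u-e
  ... | v₁ , v₂ , (g₁ , c₁) , (g₂ , c₂) , W = v₁ , v₂ , (g₁ , c₁ ∘ widen) , (g₂ , c₂ ∘ widen) , W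
    where
    widen : ∀ {v u} → Hit v u _ → Hit v u _
    widen (p , q , y′-p , rest) = p , q , D-trans E y-y′ y′-p , rest

  fork-disjoint : ∀ {P u e v₁ v₂} → Fork E P u e v₁ v₂ → ¬ (v₁ ⊒ v₂ ⊎ v₂ ⊒ v₁)
  fork-disjoint (_ , _ , W₁ , W₂) (inj₁ v₁-v₂) = proj₂ (walk-target W₂) v₁-v₂
  fork-disjoint (_ , _ , W₁ , W₂) (inj₂ v₂-v₁) = proj₂ (walk-target W₁) v₂-v₁

  -- Each walk is prolonged inside the connected region of its old prong, which is disjoint from the
  -- region of the other one.
  fork-descend : ∀ {P Q u e w₁ w₂ v₁ v₂} → Fork E P u e w₁ w₂ → w₁ ⊒ v₁ → w₂ ⊒ v₂ → Q v₁ → Q v₂ → Fork E Q u e v₁ v₂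
  fork-descend {P} {Q} {u} F@(_ , _ , W₁ , W₂) w₁-v₁ w₂-v₂ q₁ q₂ = q₁ , q₂ ,
    extend W₁ w₁-v₁ w₂-v₂ (fork-disjoint {P} F ∘ Sum.swap) , extend W₂ w₂-v₂ w₁-v₁ (fork-disjoint {P} F)
    where
    extend : ∀ {e w w′ v v′} → WalkIn G (_∖_ E (u ⊒_) (w′ ⊒_)) e w → w ⊒ v → w′ ⊒ v′ → ¬ (w′ ⊒ w ⊎ w ⊒ w′) →
             WalkIn G (_∖_ E (u ⊒_) (v′ ⊒_)) e v
    extend {w = w} W w-v w′-v′ apart = walk-trans
      (walk-mono (λ { z (u-z , w′≁z) → u-z , w′≁z ∘ D-trans E w′-v′ }) W)
      (walk-mono (λ z w-z → D-trans E (proj₁ (walk-target W)) w-z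
                          , λ v′-z → apart (D-meet E (D-trans E w′-v′ v′-z) w-z))
                 (D-connected E w _ _ (D-refl E) w-v))

  Dense : ℕ → V G → ℕ → Set
  Dense j y θ = ∀ z → (y ⊒ z × Heavy E θ z) → ∃ λ u → z ⊒ u × Good j u y

  InRegion? : ∀ y θ → Decidable (λ z → y ⊒ z × Heavy E θ z)
  InRegion? y θ z = D? E y z ×-dec Heavy? E θ z

  GoodIn? : ∀ j y z → Dec (∃ λ u → z ⊒ u × Good j u y)
  GoodIn? j y z = any? λ u → D? E z u ×-dec Good? j u y

  Dense? : ∀ j y θ → Dec (Dense j y θ)
  Dense? j y θ = all? λ z → InRegion? y θ z →-dec GoodIn? j y z

  -- The number of these vertices is the potential that `descend` increases; it is at most `τ`,
  -- since they lie in one front.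
  in-front? : ∀ v z → Decidable (λ p → p ∈ front v × z ⊒ p)
  in-front? v z p = (p ∈? front v) ×-dec D? E z p

  -- Heaviness provides a fork with prongs `w₁` and `w₂` at the very `e` where goodness fails. If
  -- both regions contained a good vertex that is not hit, `fork-descend` would produce the missing
  -- fork.
  all-hit : ∀ {j r z y′} → Heavy E (suc r) y′ → ¬ Good (suc j) y′ z →
            ∃ λ w → y′ ⊒ w × Heavy E r w × (∀ v → w ⊒ v → Good j v y′ → Hit v y′ z)
  all-hit {j} {r} {z} {y′} heavy ¬good
    with ¬∀→∃ (D? E y′) (λ e → any? λ v₁ → any? λ v₂ →
           Fork? E (λ v → Good? j v y′ ×-dec ¬? (Hit? v y′ z)) y′ e v₁ v₂) ¬good
  ... | e , y′-e , no-fork with heavy e y′-e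
  ...   | w₁ , w₂ , F@(h₁ , h₂ , W₁ , W₂) = choose (clear? w₁) (clear? w₂)
    where
    Clear : V G → Set
    Clear w = ∃ λ v → w ⊒ v × (Good j v y′ × ¬ Hit v y′ z)
    clear? : Decidable Clear
    clear? w = any? λ v → D? E w v ×-dec (Good? j v y′ ×-dec ¬? (Hit? v y′ z))
    all-hit-at : ∀ {w} → ¬ Clear w → ∀ v → w ⊒ v → Good j v y′ → Hit v y′ z
    all-hit-at none v w-v g = decidable-stable (Hit? v y′ z) (λ ¬hit → none (v , w-v , g , ¬hit))
    choose : Dec (Clear w₁) → Dec (Clear w₂) → _
    choose (no none) _ = w₁ , proj₁ (walk-target W₁) , h₁ , all-hit-at none
    choose (yes _) (no none) = w₂ , proj₁ (walk-target W₂) , h₂ , all-hit-at none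
    choose (yes (v₁ , w₁-v₁ , c₁)) (yes (v₂ , w₂-v₂ , c₂)) =
      ⊥-elim (no-fork (v₁ , v₂ , fork-descend {P = Heavy E r} F w₁-v₁ w₂-v₂ c₁ c₂))

  -- Each failure of density costs one heaviness level more than the next density gap
  -- and provides one more neighbour of the region of v.
  dense⇒good : ∀ d j y θ → Dense j y θ → Heavy E (θ + Δ τ d) y → ∃ λ u → ∃ λ y′ → Good (j + d) u y′
  dense⇒good zero j y θ dense heavy with dense y (D-refl E , subst (λ r → Heavy E r y) (+-identityʳ θ) heavy)
  ... | u , _ , good = u , y , subst (λ i → Good i u y) (sym (+-identityʳ j)) good
  dense⇒good (suc d) j y θ dense heavy with descend τ y (D-refl E) heavy
    where
    δ = suc (Δ τ d)
    descend : ∀ s z → y ⊒ z → Heavy E (θ + s * δ) z →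
      (∃ λ u → ∃ λ y′ → Good (j + suc d) u y′) ⊎
      (∃ λ v → z ⊒ v × Good j v y × s < ∣ ⟦ in-front? v z ⟧ ∣)
    descend zero z y-z h with dense z (y-z , subst (λ r → Heavy E r z) (+-identityʳ θ) h)
    -- The count starts above 0 because `v` lies in its own front.
    ... | v , z-v , good = inj₂ (v , z-v , good ,
          ≤-<-trans z≤n (⟦⟧-mono-< {P = λ _ → ⊥} (λ _ → no id) (in-front? v z) (λ _ ()) v (own∈front v , z-v) id))
    descend (suc s) z y-z h with Dense? (suc j) z (suc (θ + s * δ))
    ... | yes dense′ with dense⇒good d (suc j) z (suc (θ + s * δ)) dense′ (subst (λ r → Heavy E r z) shift h)
      where
      open +-*-Solver
      shift : θ + suc s * δ ≡ suc (θ + s * δ) + Δ τ d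
      shift = solve 3 (λ t a x → t :+ (con 1 :+ x :+ a) := con 1 :+ (t :+ a) :+ x) refl θ (s * δ) (Δ τ d)
    ...   | u , y′ , good = inj₁ (u , y′ , subst (λ i → Good i u y′) (sym (+-suc j d)) good)
    descend (suc s) z y-z h | no ¬dense
      with ¬∀→∃ (InRegion? z _) (GoodIn? (suc j) z) ¬dense
    ... | y₁ , (z-y₁ , h₁) , none with all-hit h₁ (λ good → none (y₁ , D-refl E , good))
    ...   | w , y₁-w , h₂ , hit with descend s w (D-trans E y-z (D-trans E z-y₁ y₁-w)) h₂
    ...     | inj₁ found = inj₁ found
    ...     | inj₂ (v , w-v , good , s<) with hit v w-v (Good-mono j (D-trans E y-z z-y₁) good)
    -- The new vertex `p` is adjacent to the region of `v` and outside it, hence in the front. It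
    -- lies below `z` but not below `y₁`, so it has not been counted for `w`.
    ...       | p , q , z-p , y₁≁p , v-q , pq = inj₂ (v , D-trans E z-y₁ (D-trans E y₁-w w-v) , good ,
              ≤-<-trans s< (⟦⟧-mono-< (in-front? v w) (in-front? v z)
                (λ { x (x∈ , w-x) → x∈ , D-trans E z-y₁ (D-trans E y₁-w w-x) })
                p (boundary v p q v-q pq (λ v-p → y₁≁p (D-trans E y₁-w (D-trans E w-v v-p))) , z-p)
                (λ { (_ , w-p) → y₁≁p (D-trans E y₁-w w-p) })))
  ... | inj₁ found = found
  -- After `τ` steps a single front would have more than `τ` vertices.
  ... | inj₂ (v , _ , _ , τ<) = ⊥-elim (<⇒≱ τ<
        (≤-trans (p⊆q⇒∣p∣≤∣q∣ (proj₁ ∘ ∈⟦⟧⁻ (in-front? v y))) (front-≤ v)))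

  heavy⇒good : ∀ ρ x → Heavy E (Δ τ ρ) x → ∃ λ u → ∃ λ y → Good ρ u y
  heavy⇒good ρ x = dense⇒good ρ 0 x 0 (λ z _ → z , D-refl E , tt)

  -- The root branch set `Q` is the component of `e` outside both prongs, and the subtrees come from
  -- the prongs. By `avoids` for the submodels, `Q` sees nothing of them but their roots; the
  -- absence of hits yields `avoids` for the model itself. The vertex `e` is arbitrary because the
  -- level above dictates where the region is entered.
  good⇒model : ∀ j u y → Good j u y → ∀ e → u ⊒ e → RootedModel G j (u ⊒_) e (_∖_ E (y ⊒_) (u ⊒_))
  good⇒model zero u y _ e u-e = record
    { branchᴿ = branch₀
    ; within = λ { [] v b → b }
    ; root∋ = u-e
    ; nonemptyᴿ = λ { [] _ → e , u-e }
    ; connectedᴿ = λ { [] → D-connected E u ; (_ ∷ _) _ _ () }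
    ; disjointᴿ = λ { [] [] ne → ⊥-elim (ne refl) ; [] (_ ∷ _) _ _ _ () ; (_ ∷ _) _ _ _ () }
    ; linked = λ { [] [] ne → ⊥-elim (ne refl) ; [] (_ ∷ _) _ _ () ; (_ ∷ _) _ _ () }
    ; joined = λ _ _ ()
    ; avoids = λ { [] ne → ⊥-elim (ne refl) ; (_ ∷ _) _ _ () } }
    where
    branch₀ : List Bool → V G → Set
    branch₀ [] = u ⊒_
    branch₀ (_ ∷ _) _ = ⊥
  good⇒model (suc j) u y good e u-e with good e u-e
  ... | v₁ , v₂ , F@((g₁ , c₁) , (g₂ , c₂) , W₁ , W₂) = record
    { branchᴿ = br
    ; within = within′
    ; root∋ = here (u-e , proj₂ (walk-source W₂) , proj₂ (walk-source W₁))
    ; nonemptyᴿ = λ { [] _ → e , here (u-e , proj₂ (walk-source W₂) , proj₂ (walk-source W₁))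
                    ; (b ∷ p) le → nonemptyᴿ (sub b) p (s≤s⁻¹ le) }
    ; connectedᴿ = λ { [] x y p q → walk-trans (walk-sym (walk-reach p)) (walk-reach q)
                     ; (b ∷ p) → connectedᴿ (sub b) p }
    ; disjointᴿ = disjoint′
    ; linked = linked′
    ; joined = λ { [] b _ → last b , next b , Q-last b , root∋ (sub b) , edge b
                 ; (b ∷ p) c lt → joined (sub b) p c (s≤s⁻¹ lt) }
    ; avoids = λ { [] ne → ⊥-elim (ne refl)
                 ; (b ∷ p) _ {x} {z} (y-x , u≁x) m xz →
                     clear b (x , z , y-x , u≁x , within (sub b) p z m , xz) } }
    where
    open RootedModel
    Core : V G → Set
    Core z = u ⊒ z × ¬ v₁ ⊒ z × ¬ v₂ ⊒ z
    Q : V G → Set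
    Q = WalkIn G Core e
    side : Bool → V G
    side false = v₁
    side true = v₂
    -- The walks to the prongs are cut at the first entry: the vertex before it lies in `Q`, and the
    -- vertex entered goes into the root branch set of the submodel.
    X₁ : Exit {G = G} (_∖_ E (u ⊒_) (v₂ ⊒_)) (λ z → ¬ v₁ ⊒ z) e v₁
    X₁ = first-exit (λ z → ¬? (D? E v₁ z)) W₁ (proj₂ (walk-source W₂)) (λ out → out (D-refl E))
    X₂ : Exit {G = G} (_∖_ E (u ⊒_) (v₁ ⊒_)) (λ z → ¬ v₂ ⊒ z) e v₂
    X₂ = first-exit (λ z → ¬? (D? E v₂ z)) W₂ (proj₂ (walk-source W₁)) (λ out → out (D-refl E))
    last next : Bool → V G
    last false = Exit.last X₁
    last true = Exit.last X₂
    next false = Exit.next X₁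
    next true = Exit.next X₂
    edge : ∀ b → Adj G (last b) (next b)
    edge false = Exit.edge X₁
    edge true = Exit.edge X₂
    Q-last : ∀ b → Q (last b)
    Q-last false = walk-mono (λ { z ((u-z , v₂≁z) , v₁≁z) → u-z , v₁≁z , v₂≁z }) (Exit.inside X₁)
    Q-last true = walk-mono (λ { z ((u-z , v₁≁z) , v₂≁z) → u-z , v₁≁z , v₂≁z }) (Exit.inside X₂)
    sub : ∀ b → RootedModel G j (side b ⊒_) (next b) (_∖_ E (u ⊒_) (side b ⊒_))
    sub false = good⇒model j v₁ u g₁ (Exit.next X₁) (decidable-stable (D? E v₁ _) (Exit.outside X₁))
    sub true = good⇒model j v₂ u g₂ (Exit.next X₂) (decidable-stable (D? E v₂ _) (Exit.outside X₂))
    clear : ∀ b → ¬ Hit (side b) u y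
    clear false = c₁
    clear true = c₂
    u⊒side : ∀ b → u ⊒ side b
    u⊒side false = proj₁ (walk-target W₁)
    u⊒side true = proj₁ (walk-target W₂)
    Q-outside : ∀ b {z} → Q z → ¬ side b ⊒ z
    Q-outside false q = proj₁ (proj₂ (walk-target q))
    Q-outside true q = proj₂ (proj₂ (walk-target q))
    apart : ∀ {b c} → b ≢ c → ¬ (side b ⊒ side c ⊎ side c ⊒ side b)
    apart {false} {false} ne = ⊥-elim (ne refl)
    apart {false} {true} _ = fork-disjoint {P = λ v → Good j v u × ¬ Hit v u y} F
    apart {true} {false} _ = fork-disjoint {P = λ v → Good j v u × ¬ Hit v u y} F ∘ Sum.swap
    apart {true} {true} ne = ⊥-elim (ne refl)
    br : List Bool → V G → Set
    br [] = Q
    br (b ∷ p) = branchᴿ (sub b) p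
    within′ : ∀ p v → br p v → u ⊒ v
    within′ [] v q = proj₁ (walk-target q)
    within′ (b ∷ p) v m = D-trans E (u⊒side b) (within (sub b) p v m)
    disjoint′ : ∀ p q → p ≢ q → ∀ v → br p v → ¬ br q v
    disjoint′ [] [] ne = ⊥-elim (ne refl)
    disjoint′ [] (b ∷ q) _ v x m = Q-outside b x (within (sub b) q v m)
    disjoint′ (b ∷ p) [] _ v m x = Q-outside b x (within (sub b) p v m)
    disjoint′ (b ∷ p) (c ∷ q) ne v m m′ with b 𝔹.≟ c
    ... | yes refl = disjointᴿ (sub b) p q (ne ∘ cong (b ∷_)) v m m′
    ... | no b≢c = apart b≢c (D-meet E (within (sub b) p v m) (within (sub c) q v m′))
    linked′ : ∀ p q → p ≢ q → ∀ {x z} → br p x → br q z → Adj G x z → Link p q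
    linked′ [] [] ne _ _ _ = ⊥-elim (ne refl)
    linked′ [] (b ∷ []) _ _ _ _ = inj₁ (b , refl)
    linked′ [] (b ∷ q@(_ ∷ _)) _ x m xz =
      ⊥-elim (avoids (sub b) q (λ ()) (proj₁ (walk-target x) , Q-outside b x) m xz)
    linked′ (b ∷ []) [] _ _ _ _ = inj₂ (b , refl)
    linked′ (b ∷ p@(_ ∷ _)) [] _ m x xz =
      ⊥-elim (avoids (sub b) p (λ ()) (proj₁ (walk-target x) , Q-outside b x) m (Adj-sym {G = G} xz))
    linked′ (b ∷ p) (c ∷ q) ne m m′ xz with b 𝔹.≟ c
    ... | yes refl = link-∷ b (linked (sub b) p q (ne ∘ cong (b ∷_)) m m′ xz)
    ... | no b≢c = ⊥-elim (apart b≢c (D-near E (within (sub b) p _ m) (within (sub c) q _ m′) xz))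

-- Heap numbering

-- The two constructors 2x + 1 and 2x + 2 of `ℕᵇ` are exactly the passages to the two children in
-- the heap.
turnsᵇ : ℕᵇ → List Bool
turnsᵇ zero = []
turnsᵇ 1+[2 x ] = turnsᵇ x ∷ʳ false
turnsᵇ 2[1+ x ] = turnsᵇ x ∷ʳ true

length-∷ʳ : ∀ (p : List Bool) b → length (p ∷ʳ b) ≡ suc (length p)
length-∷ʳ p b = trans (length-++ p) (trans (+-suc (length p) 0) (cong suc (+-identityʳ (length p))))

∷ʳ≢[] : ∀ (p : List Bool) {b} → p ∷ʳ b ≢ []
∷ʳ≢[] [] ()
∷ʳ≢[] (_ ∷ _) ()

turnsᵇ-injective : ∀ x y → turnsᵇ x ≡ turnsᵇ y → x ≡ y
turnsᵇ-injective zero zero _ = refl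
turnsᵇ-injective zero 1+[2 y ] e = ⊥-elim (∷ʳ≢[] (turnsᵇ y) (sym e))
turnsᵇ-injective zero 2[1+ y ] e = ⊥-elim (∷ʳ≢[] (turnsᵇ y) (sym e))
turnsᵇ-injective 1+[2 x ] zero e = ⊥-elim (∷ʳ≢[] (turnsᵇ x) e)
turnsᵇ-injective 2[1+ x ] zero e = ⊥-elim (∷ʳ≢[] (turnsᵇ x) e)
turnsᵇ-injective 1+[2 x ] 1+[2 y ] e = cong 1+[2_] (turnsᵇ-injective x y (∷ʳ-injectiveˡ _ _ e))
turnsᵇ-injective 2[1+ x ] 2[1+ y ] e = cong 2[1+_] (turnsᵇ-injective x y (∷ʳ-injectiveˡ _ _ e))
turnsᵇ-injective 1+[2 x ] 2[1+ y ] e with ∷ʳ-injectiveʳ (turnsᵇ x) (turnsᵇ y) e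
... | ()
turnsᵇ-injective 2[1+ x ] 1+[2 y ] e with ∷ʳ-injectiveʳ (turnsᵇ x) (turnsᵇ y) e
... | ()

-- Each turn at least doubles the successor of the heap number. This bounds the depth of the
-- vertices of `bin ρ`.
2^length-turnsᵇ : ∀ x → 2 ^ length (turnsᵇ x) ≤ suc (ℕᵇ.toℕ x)
2^length-turnsᵇ zero = ≤-refl
2^length-turnsᵇ 1+[2 x ] = subst (λ l → 2 ^ l ≤ suc (suc (2 * ℕᵇ.toℕ x))) (sym (length-∷ʳ (turnsᵇ x) false))
  (≤-trans (*-monoʳ-≤ 2 (2^length-turnsᵇ x)) (≤-reflexive (*-suc 2 (ℕᵇ.toℕ x))))
2^length-turnsᵇ 2[1+ x ] = subst (λ l → 2 ^ l ≤ suc (2 * suc (ℕᵇ.toℕ x))) (sym (length-∷ʳ (turnsᵇ x) true))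
  (≤-trans (*-monoʳ-≤ 2 (2^length-turnsᵇ x)) (n≤1+n _))

-- Heap numbering is bijective base 2, read from the root.
turns : ℕ → List Bool
turns i = turnsᵇ (ℕᵇ.fromℕ i)

fromℕ-toℕ : ∀ x {i} → ℕᵇ.toℕ x ≡ i → ℕᵇ.fromℕ i ≡ x
fromℕ-toℕ x {i} e = ℕᵇ.toℕ-injective (trans (ℕᵇ.toℕ-fromℕ i) (sym e))

turns-injective : ∀ i j → turns i ≡ turns j → i ≡ j
turns-injective i j e = trans (sym (ℕᵇ.toℕ-fromℕ i))
  (trans (cong ℕᵇ.toℕ (turnsᵇ-injective (ℕᵇ.fromℕ i) (ℕᵇ.fromℕ j) e)) (ℕᵇ.toℕ-fromℕ j))

turns-odd : ∀ i → turns (suc (i + i)) ≡ turns i ∷ʳ false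
turns-odd i = cong turnsᵇ (fromℕ-toℕ 1+[2 ℕᵇ.fromℕ i ]
  (trans (cong (λ n → suc (2 * n)) (ℕᵇ.toℕ-fromℕ i)) (cong (λ n → suc (i + n)) (+-identityʳ i))))

turns-even : ∀ i → turns (suc (suc (i + i))) ≡ turns i ∷ʳ true
turns-even i = cong turnsᵇ (fromℕ-toℕ 2[1+ ℕᵇ.fromℕ i ]
  (trans (cong (λ n → 2 * suc n) (ℕᵇ.toℕ-fromℕ i))
         (trans (cong (λ n → suc (i + suc n)) (+-identityʳ i)) (cong suc (+-suc i i)))))

child⇒turns : ∀ i j → T (child i j) → ∃ λ b → turns j ≡ turns i ∷ʳ b
child⇒turns i j c with Equivalence.to T-∨ c
... | inj₁ t = false , trans (cong turns (≡ᵇ⇒≡ j _ t)) (turns-odd i)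
... | inj₂ t = true , trans (cong turns (≡ᵇ⇒≡ j _ t)) (turns-even i)

turns⇒child : ∀ i j b → turns j ≡ turns i ∷ʳ b → T (child i j)
turns⇒child i j false e = Equivalence.from T-∨ (inj₁ (≡⇒≡ᵇ j _ (turns-injective j _ (trans e (sym (turns-odd i))))))
turns⇒child i j true e = Equivalence.from (T-∨ {j ℕ.≡ᵇ suc (i + i)})
  (inj₂ (≡⇒≡ᵇ j _ (turns-injective j _ (trans e (sym (turns-even i))))))

length-turns : ∀ ρ i → i < 2 ^ suc ρ ∸ 1 → length (turns i) ≤ ρ
length-turns ρ i i< = ≮⇒≥ λ ρ<l → <⇒≱ (≤-<-trans bound (≤-<-trans i< pred<)) (^-monoʳ-≤ 2 ρ<l)
  where
  bound : 2 ^ length (turns i) ≤ suc i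
  bound = subst (λ n → 2 ^ length (turns i) ≤ suc n) (ℕᵇ.toℕ-fromℕ i) (2^length-turnsᵇ (ℕᵇ.fromℕ i))
  pred< : 2 ^ suc ρ ∸ 1 < 2 ^ suc ρ
  pred< = ≤-reflexive (m+[n∸m]≡n (m^n>0 2 (suc ρ)))

-- From rooted models to induced minors; edgeless graphs.

module _ {G : Graph} where

  rooted⇒induced-minor : ∀ {ρ X e P} → RootedModel G ρ X e P → HasInducedMinor G (bin ρ)
  rooted⇒induced-minor {ρ} R = record
    { branch = λ x → branchᴿ (turns (toℕ x))
    ; nonempty = λ x → nonemptyᴿ (turns (toℕ x)) (shallow x)
    ; connected = λ x → connectedᴿ (turns (toℕ x))
    ; disjoint = λ x y x≢y v p q → disjointᴿ _ _ (distinct x≢y) v p q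
    ; edges = λ x y x≢y → mk⇔ (to x y) (from x y x≢y) }
    where
    open RootedModel R
    shallow : ∀ (x : V (bin ρ)) → length (turns (toℕ x)) ≤ ρ
    shallow x = length-turns ρ (toℕ x) (toℕ<n x)
    distinct : ∀ {x y : V (bin ρ)} → x ≢ y → turns (toℕ x) ≢ turns (toℕ y)
    distinct x≢y e = x≢y (toℕ-injective (turns-injective _ _ e))
    down : ∀ (x y : V (bin ρ)) → T (child (toℕ x) (toℕ y)) →
           ∃ λ u → ∃ λ v → branchᴿ (turns (toℕ x)) u × branchᴿ (turns (toℕ y)) v × Adj G u v
    down x y c with child⇒turns (toℕ x) (toℕ y) c
    ... | b , e with joined (turns (toℕ x)) b
                       (≤-trans (≤-reflexive (sym (trans (cong length e) (length-∷ʳ (turns (toℕ x)) b)))) (shallow y))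
    ...   | u , v , bu , bv , uv = u , v , bu , subst (λ p → branchᴿ p v) (sym e) bv , uv
    to : ∀ x y → Adj (bin ρ) x y →
         ∃ λ u → ∃ λ v → branchᴿ (turns (toℕ x)) u × branchᴿ (turns (toℕ y)) v × Adj G u v
    to x y xy with Equivalence.to (T-∨ {child (toℕ x) (toℕ y)}) (Equivalence.from T-≡ xy)
    ... | inj₁ c = down x y c
    ... | inj₂ c with down y x c
    ...   | u , v , bu , bv , uv = v , u , bv , bu , Adj-sym {G = G} uv
    from : ∀ x y → x ≢ y →
           (∃ λ u → ∃ λ v → branchᴿ (turns (toℕ x)) u × branchᴿ (turns (toℕ y)) v × Adj G u v) → Adj (bin ρ) x y
    from x y x≢y (u , v , bu , bv , uv) =
      Equivalence.to T-≡ (Equivalence.from (T-∨ {child (toℕ x) (toℕ y)})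
        (Sum.map (λ { (b , e) → turns⇒child (toℕ x) (toℕ y) b e })
                      (λ { (b , e) → turns⇒child (toℕ y) (toℕ x) b e })
                      (linked _ _ (distinct x≢y) bu bv uv)))

  -- Serves the case τ = 1, where the bound to be reached is 1 and an estimate by multiples of 5 τ
  -- is too coarse.
  edgeless-layout : (∀ u v → ¬ Adj G u v) → Layout {G} (λ _ → ⊤) 1
  edgeless-layout none = record
    { pos = toℕ
    ; bagᴸ = at
    ; bag-size = at-size
    ; bag-⊇ = λ { i u (_ , inj₁ refl) → at-own u ; i u (_ , inj₂ (_ , v , _ , a , _)) → ⊥-elim (none u v a) } }
    where
    at : ℕ → Subset (size G)
    at i with i ℕ.<? size G
    ... | yes i< = ⁅ fromℕ< i< ⁆
    ... | no _ = Sub.⊥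
    at-size : ∀ i → ∣ at i ∣ ≤ 1
    at-size i with i ℕ.<? size G
    ... | yes i< = ≤-reflexive (∣⁅x⁆∣≡1 (fromℕ< i<))
    ... | no _ = ≤-trans (≤-reflexive (∣⊥∣≡0 (size G))) z≤n
    at-own : ∀ u → u ∈ at (toℕ u)
    at-own u with toℕ u ℕ.<? size G
    ... | yes u< = subst (λ z → u ∈ ⁅ z ⁆) (sym (fromℕ<-toℕ u u<)) (x∈⁅x⁆ u)
    ... | no u≮ = ⊥-elim (u≮ (toℕ<n u))

  singleton-bags⇒edgeless : (TD : TreeDecomposition G) → (∀ t → ∣ bag TD t ∣ ≤ 1) → ∀ u v → ¬ Adj G u v
  singleton-bags⇒edgeless TD small u v uv with cover-edge TD u v uv
  ... | t , u∈t , v∈t = <⇒≱ (p⊂q⇒∣p∣<∣q∣ {p = ⁅ u ⁆}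
          ( (λ {x} x∈ → subst (_∈ bag TD t) (sym (x∈⁅y⁆⇒x≡y u x∈)) u∈t)
          , v , v∈t , λ v∈u → Adj-irrefl {G = G} uv (sym (x∈⁅y⁆⇒x≡y u v∈u))))
          (≤-trans (small t) (≤-reflexive (sym (∣⁅x⁆∣≡1 u))))

-- Numerical estimates and the theorem.

-- The extra summand `τ` strengthens the induction: after factoring out `τ`, a 2 is left over, which
-- is at most `τ`.
Δ-bound : ∀ τ ρ → 2 ≤ τ → Δ τ ρ + τ ≤ τ ^ suc ρ
Δ-bound τ zero _ = ≤-reflexive (sym (*-identityʳ τ))
Δ-bound τ (suc ρ) 2≤τ = begin
  τ * suc (Δ τ ρ) + τ ≡⟨ solve 2 (λ t d → t :* (con 1 :+ d) :+ t := t :* (d :+ con 2)) refl τ (Δ τ ρ) ⟩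
  τ * (Δ τ ρ + 2)     ≤⟨ *-monoʳ-≤ τ (+-monoʳ-≤ (Δ τ ρ) 2≤τ) ⟩
  τ * (Δ τ ρ + τ)     ≤⟨ *-monoʳ-≤ τ (Δ-bound τ ρ 2≤τ) ⟩
  τ ^ suc (suc ρ)     ∎
  where
  open ≤-Reasoning
  open +-*-Solver

width-bound : ∀ τ ρ → 2 ≤ τ → 1 ≤ ρ → Δ τ ρ * (5 * τ) ≤ τ ^ (6 * ρ + 2)
width-bound τ@(suc _) ρ 2≤τ 1≤ρ = begin
  Δ τ ρ * (5 * τ)           ≤⟨ *-mono-≤ (≤-trans (m≤m+n (Δ τ ρ) τ) (Δ-bound τ ρ 2≤τ)) (*-monoˡ-≤ τ 5≤τ³) ⟩
  τ ^ suc ρ * (τ ^ 3 * τ)   ≡⟨ cong (τ ^ suc ρ *_) (*-comm (τ ^ 3) τ) ⟩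
  τ ^ suc ρ * τ ^ 4         ≡⟨ sym (^-distribˡ-+-* τ (suc ρ) 4) ⟩
  τ ^ (suc ρ + 4)           ≤⟨ ^-monoʳ-≤ τ exponent ⟩
  τ ^ (6 * ρ + 2)           ∎
  where
  open ≤-Reasoning
  open +-*-Solver
  -- The sum 5 + 3 below is the cube of 2.
  5≤τ³ : 5 ≤ τ ^ 3
  5≤τ³ = ≤-trans (m≤m+n 5 3) (^-monoˡ-≤ 3 2≤τ)
  exponent : suc ρ + 4 ≤ 6 * ρ + 2
  exponent = begin
    suc ρ + 4       ≡⟨ solve 1 (λ r → con 1 :+ r :+ con 4 := r :+ con 2 :+ con 3) refl ρ ⟩
    ρ + 2 + 3       ≤⟨ +-monoʳ-≤ (ρ + 2) (≤-trans (m≤m+n 3 2) (*-monoʳ-≤ 5 1≤ρ)) ⟩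
    ρ + 2 + 5 * ρ   ≡⟨ solve 1 (λ r → r :+ con 2 :+ con 5 :* r := con 6 :* r :+ con 2) refl ρ ⟩
    6 * ρ + 2       ∎

theorem3p1 : (ρ τ : ℕ) → 1 ≤ ρ → 1 ≤ τ → (G : Graph) →
    TreewidthLess G τ → ¬ HasInducedMinor G (bin ρ) →
    PathwidthLess G (τ ^ (6 * ρ + 2))
-- Bags with at most one vertex leave no room for an edge, and every power of 1 is 1.
theorem3p1 ρ (suc zero) _ _ G (TD , width) _ = layout⇒pathwidth
  (layout-≤ (m^n>0 1 (6 * ρ + 2)) (edgeless-layout (singleton-bags⇒edgeless TD width)))
theorem3p1 ρ τ@(suc (suc _)) 1≤ρ _ G (TD , width) no-bin = layout⇒pathwidth
  (layout-≤ (width-bound τ ρ (s≤s (s≤s z≤n)) 1≤ρ) (layout-light E (Δ τ ρ) (λ u _ → light u)))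
  where
  E : EliminationOrder τ
  E = eliminationOrder TD width (fromℕ< (proj₁ (isTree TD)))
  light : ∀ u → ¬ Heavy E (Δ τ ρ) u
  light x h with heavy⇒good E ρ x h
  ... | u , y , good = no-bin (rooted⇒induced-minor (good⇒model E ρ u y good u (D-refl E)))
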